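{- Let $n,\mu\in\mathbb{N}_0$ and $m\in\mathbb{N}$. Let $(c_j)_{j\ge 0}$ be the Cauchy numbers, let $s(\cdot,\cdot)$ and $S(\cdot,\cdot)$ be the Stirling numbers of the first and second kind, respectively, let $(\theta)_j$ be the descending factorial, and let $$\rho_m(\theta)=\frac{1}{(m-1)!}\sum_{k=0}^{m-1}\binom{m}{k}(-1)^k(\theta-k)_+^{m-1},\qquad \theta\in[0,m].$$ Then $$\sum_{\substack{l_1+\cdots+l_m=\mu\\ l_1,\ldots,l_m\ge 0}}\binom{\mu}{l_1,\ldots,l_m}\sum_{\substack{k_1+\cdots+k_m=n\\ k_1,\ldots,k_m\ge 0}}\binom{n}{k_1,\ldots,k_m}\,c_{k_1+l_1}\cdots c_{k_m+l_m}=\int_0^m(\theta)_{\mu+n}\,\rho_m(\theta)\,d\theta=\sum_{k=0}^{\mu+n}\frac{s(\mu+n,k)\,S(m+k,m)}{\binom{m+k}{m}}.$$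
   Context: $\mathbb{N}$ is the set of positive integers and $\mathbb{N}_0=\mathbb{N}\cup\{0\}$. Descending factorial: $(\theta)_0=1$ and $(\theta)_j=\theta(\theta-1)\cdots(\theta-j+1)$ for $j\ge 1$. The Cauchy numbers $(c_j)_{j\ge0}$ are defined by the generating function $\frac{z}{\log(1+z)}=\sum_{j=0}^\infty c_j\frac{z^j}{j!}$ for $z\in\mathbb{C}$, $|z|<1$, or equivalently by $c_j=\int_0^1(\theta)_j\,d\theta$, $j\in\mathbb{N}_0$. The Stirling numbers of the first kind $s(j,k)$ and of the second kind $S(j,k)$, $k=0,1,\ldots,j$, are defined by $(x)_j=\sum_{k=0}^j s(j,k)x^k$ and $x^j=\sum_{k=0}^j S(j,k)(x)_k$ for $x\in\mathbb{R}$. $x_+=\max(x,0)$; for $m=1$ the power $(\theta-k)_+^{0}$ with $k=0$ is taken to be $1$, so that $\rho_1(\theta)=1$ on $[0,1]$. The multinomial coefficient is $\binom{n}{k_1,\ldots,k_m}=\frac{n!}{k_1!\cdots k_m!}$ for $k_1,\ldots,k_m\in\mathbb{N}_0$ with $k_1+\cdots+k_m=n$. All sums run over tuples of nonnegative integers. -}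

module Defs where

open import Level using () renaming (suc to sucˡ; _⊔_ to _⊔ˡ_)
open import Data.Nat.Base as ℕ using (ℕ; zero; suc; NonZero; _!; _∸_)
import Data.Nat.Properties as ℕ
open import Data.Nat.Combinatorics using (_C_; nCk≡n!/k![n-k]!)
open import Data.Nat.Combinatorics.Specification using ([n∸k]!k!∣n!)
open import Data.Nat.Divisibility using (_∣_; ∣⇒≤)
open import Data.Nat.DivMod using (m≥n⇒m/n>0)
open import Data.Fin.Base using (zero; suc; toℕ)
open import Data.List.Base as List using (List; []; _∷_)
open import Data.Vec.Functional as Vector using (Vector)
open import Data.Product.Base using (∃-syntax; proj₁; proj₂)
  renaming (_×_ to _∧_)
open import Data.Sum.Base using (_⊎_; inj₂)
open import Function.Base using (_∘_)
open import Relation.Nullary.Negation using (¬_)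
open import Relation.Binary.Core using (Rel)
open import Relation.Binary.Definitions using (Cotransitive)
open import Relation.Binary.Structures using (IsStrictPartialOrder)
open import Relation.Binary.Lattice.Structures using (IsJoinSemilattice)
open import Relation.Binary.PropositionalEquality.Core using (subst)
  renaming (sym to ≡-sym)
open import Algebra.Core using (Op₁; Op₂)
open import Algebra.Bundles using (CommutativeRing; Semiring)
open import Algebra.Apartness.Structures using (IsHeytingField)
import Algebra.Definitions.RawSemiring as RawSemiringDefinitions

-- The real numbers: a Cauchy-complete Archimedean ordered field.  This
-- determines ℝ up to isomorphism.  The axioms are constructively
-- phrased (the order is cotransitive rather than total, and binary
-- maxima are part of the structure), so that they hold for the Bishop
-- reals as well as for the classical ones.

record RealNumbers c ℓ₁ ℓ₂ : Set (sucˡ (c ⊔ˡ ℓ₁ ⊔ˡ ℓ₂)) where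
  infix  8 -_
  infixl 7 _*_
  infixl 6 _+_ _⊔_
  infix  4 _≈_ _<_ _≤_ _#_
  field
    Carrier : Set c
    _≈_     : Rel Carrier ℓ₁
    _<_     : Rel Carrier ℓ₂
    _+_     : Op₂ Carrier
    _*_     : Op₂ Carrier
    -_      : Op₁ Carrier
    0#      : Carrier
    1#      : Carrier
    _⊔_     : Op₂ Carrier

  _#_ : Rel Carrier ℓ₂
  x # y = x < y ⊎ y < x

  _≤_ : Rel Carrier ℓ₂
  x ≤ y = ¬ (y < x)

  field
    isHeytingField       : IsHeytingField _≈_ _#_ _+_ _*_ -_ 0# 1#
    isStrictPartialOrder : IsStrictPartialOrder _≈_ _<_
    <-cotrans            : Cotransitive _<_
    isJoinSemilattice    : IsJoinSemilattice _≈_ _≤_ _⊔_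
    0<1                  : 0# < 1#
    +-monoˡ-<            : ∀ {x y} z → x < y → x + z < y + z
    *-pos                : ∀ {x y} → 0# < x → 0# < y → 0# < x * y

  open IsHeytingField isHeytingField public

  commutativeRing : CommutativeRing c ℓ₁
  commutativeRing = record { isCommutativeRing = isCommutativeRing }

  open RawSemiringDefinitions
    (Semiring.rawSemiring (CommutativeRing.semiring commutativeRing)) public
    using (_×_; _^_; sum; product)

  fromℕ : ℕ → Carrier
  fromℕ n = n × 1#

  ∣_∣ : Carrier → Carrier
  ∣ x ∣ = x ⊔ (- x)

  IsCauchySequence : (ℕ → Carrier) → Set (c ⊔ˡ ℓ₂)
  IsCauchySequence x = ∀ ε → 0# < ε → ∃[ N ] ∀ i j → N ℕ.≤ i → N ℕ.≤ j →
    ∣ x i - x j ∣ < ε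

  _ConvergesTo_ : (ℕ → Carrier) → Carrier → Set (c ⊔ˡ ℓ₂)
  x ConvergesTo l = ∀ ε → 0# < ε → ∃[ N ] ∀ i → N ℕ.≤ i → ∣ x i - l ∣ < ε

  field
    archimedean : ∀ x → ∃[ n ] x < fromℕ n
    complete    : ∀ x → IsCauchySequence x → ∃[ l ] x ConvergesTo l

------------------------------------------------------------------------
-- Tuples of nonnegative integers

-- All (k₁ , … , kₘ) with k₁ + ⋯ + kₘ = n, each listed once.

tuples : (m n : ℕ) → List (Vector ℕ m)
tuples zero    zero    = Vector.[] ∷ []
tuples zero    (suc n) = []
tuples (suc m) n       =
  List.concatMap (λ k → List.map (k Vector.∷_) (tuples m (n ∸ k)))
                 (List.upTo (suc n))

∏! : ∀ {m} → Vector ℕ m → ℕ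
∏! ks = Vector.foldr ℕ._*_ 1 (Vector.map _! ks)

∏!≢0 : ∀ {m} (ks : Vector ℕ m) → NonZero (∏! ks)
∏!≢0 {zero}  ks = _
∏!≢0 {suc m} ks = ℕ.m*n≢0 _ _ {{ks zero ℕ.!≢0}} {{∏!≢0 (ks ∘ suc)}}

C≢0 : ∀ m k → NonZero ((m ℕ.+ k) C m)
C≢0 m k = ℕ.>-nonZero (subst (0 ℕ.<_) (≡-sym (nCk≡n!/k![n-k]! m≤m+k))
  (m≥n⇒m/n>0 {{m ℕ.!* (m ℕ.+ k ∸ m) !≢0}}
    (∣⇒≤ {{(m ℕ.+ k) ℕ.!≢0}}
      (subst (_∣ (m ℕ.+ k) !) (ℕ.*-comm ((m ℕ.+ k ∸ m) !) (m !)) ([n∸k]!k!∣n! m≤m+k)))))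
  where m≤m+k = ℕ.m≤m+n m k

------------------------------------------------------------------------

module RealAnalysis {c ℓ₁ ℓ₂} (R : RealNumbers c ℓ₁ ℓ₂) where

  open RealNumbers R renaming (Carrier to ℝ)

  0<fromℕ : ∀ n .{{_ : NonZero n}} → 0# < fromℕ n
  0<fromℕ (suc zero)    = <-respʳ-≈ (sym (+-identityʳ 1#)) 0<1
    where
    open IsStrictPartialOrder isStrictPartialOrder using (<-respʳ-≈)
  0<fromℕ (suc (suc n)) = <-trans (0<fromℕ (suc n))
    (<-respˡ-≈ (+-identityˡ _) (+-monoˡ-< (fromℕ (suc n)) 0<1))
    where
    open IsStrictPartialOrder isStrictPartialOrder using (<-respˡ-≈)
      renaming (trans to <-trans)

  recip : ∀ n .{{_ : NonZero n}} → ℝ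
  recip n = proj₁ (#⇒invertible {fromℕ n} {0#} (inj₂ (0<fromℕ n)))

  -- #⇒invertible literally inverts fromℕ n - 0#.
  recip-inverse : ∀ n .{{_ : NonZero n}} → recip n * fromℕ n ≈ 1#
  recip-inverse n = begin
    recip n * fromℕ n         ≈⟨ *-congˡ (+-identityʳ _) ⟨
    recip n * (fromℕ n + 0#)  ≈⟨ *-congˡ (+-congˡ -0#≈0#) ⟨
    recip n * (fromℕ n - 0#)  ≈⟨ proj₁ (proj₂ (#⇒invertible (inj₂ (0<fromℕ n)))) ⟩
    1#                        ∎
    where
    open import Algebra.Properties.Ring (CommutativeRing.ring commutativeRing) using (-0#≈0#)
    open import Relation.Binary.Reasoning.Setoid setoid

  infixl 7 _÷_
  _÷_ : ℝ → (n : ℕ) .{{_ : NonZero n}} → ℝ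
  x ÷ n = x * recip n

  ----------------------------------------------------------------------
  -- Finite sums

  sum< : ℕ → (ℕ → ℝ) → ℝ
  sum< n f = sum {n} (f ∘ toℕ)

  sumOver : ∀ {a} {A : Set a} → List A → (A → ℝ) → ℝ
  sumOver xs f = List.foldr _+_ 0# (List.map f xs)

  infix 5 sum< sumOver
  syntax sum< n (λ k → e)     = ∑[ k < n ] e
  syntax sumOver xs (λ x → e) = ∑[ x ∈ xs ] e

  multinomial : ∀ {m} → ℕ → Vector ℕ m → ℝ
  multinomial n ks = (fromℕ (n !) ÷ ∏! ks) {{∏!≢0 ks}}

  ----------------------------------------------------------------------
  -- The Riemann integral

  data TaggedPartition : ℝ → ℝ → Set (c ⊔ˡ ℓ₁ ⊔ˡ ℓ₂) where
    end  : ∀ {a b} → a ≈ b → TaggedPartition a b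
    cell : ∀ {a b} (tag next : ℝ) → a ≤ tag → tag ≤ next →
           TaggedPartition next b → TaggedPartition a b

  riemannSum : ∀ {a b} → (ℝ → ℝ) → TaggedPartition a b → ℝ
  riemannSum f (end _) = 0#
  riemannSum {a} f (cell tag next _ _ p) = f tag * (next - a) + riemannSum f p

  data FinerThan (δ : ℝ) : ∀ {a b} → TaggedPartition a b →
                           Set (c ⊔ˡ ℓ₁ ⊔ˡ ℓ₂) where
    end  : ∀ {a b} {a≈b : a ≈ b} → FinerThan δ (end a≈b)
    cell : ∀ {a b tag next a≤t t≤n} {p : TaggedPartition next b} →
           next - a < δ → FinerThan δ p →
           FinerThan δ (cell {a} {b} tag next a≤t t≤n p)

  -- The integral of f from a to b exists and equals I (for a ≤ b).
  IsIntegral : (a b : ℝ) → (ℝ → ℝ) → ℝ → Set (c ⊔ˡ ℓ₁ ⊔ˡ ℓ₂)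
  IsIntegral a b f I = ∀ ε → 0# < ε → ∃[ δ ] (0# < δ) ∧
    (∀ (p : TaggedPartition a b) → FinerThan δ p → ∣ riemannSum f p - I ∣ < ε)

  ----------------------------------------------------------------------

  infix 9 _↓_
  _↓_ : ℝ → ℕ → ℝ
  θ ↓ zero    = 1#
  θ ↓ (suc j) = θ ↓ j * (θ - fromℕ j)

  IsCauchyNumbers : (ℕ → ℝ) → Set (c ⊔ˡ ℓ₁ ⊔ˡ ℓ₂)
  IsCauchyNumbers c = ∀ j → IsIntegral 0# 1# (λ θ → θ ↓ j) (c j)

  -- The array s is determined for k ≤ j and unconstrained (and never
  -- used) for k > j; likewise S below.
  IsStirlingFirst : (ℕ → ℕ → ℝ) → Set (c ⊔ˡ ℓ₁)
  IsStirlingFirst s = ∀ j x → x ↓ j ≈ (∑[ k < suc j ] s j k * x ^ k)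

  IsStirlingSecond : (ℕ → ℕ → ℝ) → Set (c ⊔ˡ ℓ₁)
  IsStirlingSecond S = ∀ j x → x ^ j ≈ (∑[ k < suc j ] S j k * x ↓ k)

  _₊ : ℝ → ℝ
  x ₊ = x ⊔ 0#

  -- x ^ 0 is 1# for every x; for m = 1 the only term is k = 0, so ρ 1 is
  -- identically 1.
  ρ : (m : ℕ) → ℝ → ℝ
  ρ m θ = ((∑[ k < m ] fromℕ (m C k) * (- 1#) ^ k * ((θ - fromℕ k) ₊) ^ (m ∸ 1))
            ÷ (m ∸ 1) !) {{(m ∸ 1) ℕ.!≢0}}

-- Let U₁, …, Uₘ be independent and uniform on [0 , 1].  All three expressions
-- are the expectation of (U₁ + ⋯ + Uₘ) ↓ N for N = μ + n.  The left-hand side is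
-- an m-fold binomial convolution of the Cauchy numbers, and Vandermonde's
-- identity for falling factorials turns it into that expectation.  The k-th
-- moment of U₁ + ⋯ + Uₘ is the m-th difference at 0 of the m-th primitive of
-- x ↦ xᵏ, which is S (m + k) m / ((m + k) C m).  Integrating θᵏ ρ m θ by parts
-- leaves the same difference, because all boundary terms are polynomials of
-- degree less than m in the knots.  The integrals themselves reduce to
-- truncated powers, which are monotone, so that Riemann sums are bounded by a
-- telescoping sum.

module Submission where

open import Defs
open import Algebra.Bundles using (CommutativeRing)
import Algebra.Properties.Ring
import Algebra.Properties.Semiring.Exp
import Algebra.Properties.Semiring.Mult
import Algebra.Properties.Semiring.Mult.TCOptimised
import Algebra.Solver.Ring
open import Algebra.Solver.Ring.AlmostCommutativeRing
  using (fromCommutativeRing; _-Raw-AlmostCommutative⟶_)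
open import Data.Integer.Base as ℤ using (ℤ; +_; -[1+_])
import Data.Integer.Properties as ℤ
open import Data.List.Base as List using (List; []; _∷_)
open import Data.Maybe.Base using (Maybe; just; nothing)
open import Data.Nat.Base as ℕ using (ℕ; zero; suc; NonZero; _!; _∸_; z≤n; s≤s)
open import Data.Nat.Combinatorics
  using (_C_; nCk≡n!/k![n-k]!; k![n∸k]!∣n!; k>n⇒nCk≡0; nCk+nC[k+1]≡[n+1]C[k+1])
import Data.Nat.DivMod as ℕ
import Data.Nat.Properties as ℕ
open import Data.Product.Base using (∃-syntax; _,_) renaming (_×_ to _∧_)
open import Data.Sum.Base using (_⊎_; inj₁; inj₂; [_,_]′)
open import Data.Vec.Functional as Vector using (Vector)
open import Function.Base using (_∘_; id)
import Relation.Binary.Reasoning.Base.Triple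
import Relation.Binary.Reasoning.Setoid
open import Relation.Binary.Lattice.Structures using (IsJoinSemilattice)
open import Relation.Binary.PropositionalEquality.Core as ≡ using (_≡_)
open import Relation.Binary.Structures using (IsStrictPartialOrder)
open import Relation.Nullary.Decidable using (yes; no)
open import Relation.Nullary.Negation using (¬_; contradiction)

-- No random variable and no multiple integral occurs, so the expectation has to be carried by a
-- parameter. The convolution and the moments are stated for a start `x ≥ 0`; a further uniform
-- variable is a single integral over `u` in [0 , 1] that moves `x` to `x + u`, and `x = 0` is taken
-- only at the end. This generalisation is what makes the induction on `m` go through. It is also
-- the only place where uniqueness of an integral is used. The left-hand side and the integral
-- against `ρ` are never compared directly: each is evaluated to the Stirling sum. On the side of
-- `ρ`, integration by parts is not a theorem about integrals but an algebraic identity between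
-- explicit values, polynomials in the knot `κ`, so that finite differences in `κ` can be applied to
-- it. The order is constructive. Since `≤` is a negated `<`, weak inequalities, and by antisymmetry
-- equations, may be split at the sign of `θ - κ`; strict inequalities need cotransitivity instead.

module _ {a ℓ₁ ℓ₂} (R : RealNumbers a ℓ₁ ℓ₂) where

  open RealNumbers R renaming (Carrier to ℝ)
  open RealAnalysis R
  open CommutativeRing commutativeRing using (ring; semiring)
  open Algebra.Properties.Ring ring
    using (-‿distribˡ-*; -‿distribʳ-*; -‿involutive; -‿+-comm; -0#≈0#)
  module Mult = Algebra.Properties.Semiring.Mult semiring
  module Mult′ = Algebra.Properties.Semiring.Mult.TCOptimised semiring
  open Algebra.Properties.Semiring.Exp semiring using (^-congˡ)
  module ≈-Reasoning = Relation.Binary.Reasoning.Setoid setoid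

  fromℕ-+ : ∀ m n → fromℕ (m ℕ.+ n) ≈ fromℕ m + fromℕ n
  fromℕ-+ = Mult.×-homo-+ 1#

  fromℕ-* : ∀ m n → fromℕ (m ℕ.* n) ≈ fromℕ m * fromℕ n
  fromℕ-* = Mult.×1-homo-*

  -- Ring normalisation with integer coefficients, so that cancellation is decided.

  fromℤ : ℤ → ℝ
  fromℤ (+ n)    = n Mult′.× 1#
  fromℤ -[1+ n ] = - (suc n Mult′.× 1#)

  private
    -- `fromℤ` is built on the optimised multiple because there `1 × 1#` reduces to `1#`, so that
    -- `con (+ 1)` denotes `1#` itself. The term `fromℕ 1` is `1# + 0#`, which solver equations have
    -- to spell out as `con (+ 1) :+ con (+ 0)`.
    ×′≈fromℕ : ∀ n → n Mult′.× 1# ≈ fromℕ n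
    ×′≈fromℕ n = sym (Mult′.×ᵤ≈× n 1#)

    cancel-suc : ∀ x y → x - y ≈ (1# + x) - (1# + y)
    cancel-suc x y = begin
      x - y                    ≈⟨ +-identityˡ _ ⟨
      0# + (x - y)             ≈⟨ +-congʳ (-‿inverseʳ 1#) ⟨
      (1# - 1#) + (x - y)      ≈⟨ +-assoc _ _ _ ⟩
      1# + (- 1# + (x - y))    ≈⟨ +-congˡ (+-assoc _ _ _) ⟨
      1# + ((- 1# + x) - y)    ≈⟨ +-congˡ (+-congʳ (+-comm _ _)) ⟩
      1# + ((x - 1#) - y)      ≈⟨ +-congˡ (+-assoc _ _ _) ⟩
      1# + (x + (- 1# - y))    ≈⟨ +-assoc _ _ _ ⟨
      (1# + x) + (- 1# - y)    ≈⟨ +-congˡ (-‿+-comm 1# y) ⟩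
      (1# + x) - (1# + y)      ∎
      where open ≈-Reasoning

    fromℤ-⊖ : ∀ m n → fromℤ (m ℤ.⊖ n) ≈ fromℕ m - fromℕ n
    fromℤ-⊖ zero    zero    = sym (-‿inverseʳ 0#)
    fromℤ-⊖ zero    (suc n) = trans (-‿cong (×′≈fromℕ (suc n))) (sym (+-identityˡ _))
    fromℤ-⊖ (suc m) zero    = trans (×′≈fromℕ (suc m)) (sym (trans (+-congˡ -0#≈0#) (+-identityʳ _)))
    fromℤ-⊖ (suc m) (suc n) rewrite ℤ.[1+m]⊖[1+n]≡m⊖n m n =
      trans (fromℤ-⊖ m n) (cancel-suc (fromℕ m) (fromℕ n))

    fromℤ-+ : ∀ i j → fromℤ (i ℤ.+ j) ≈ fromℤ i + fromℤ j
    fromℤ-+ (+ m)    (+ n)    = Mult′.×-homo-+ 1# m n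
    fromℤ-+ (+ m)    -[1+ n ] = trans (fromℤ-⊖ m (suc n))
      (sym (+-cong (×′≈fromℕ m) (-‿cong (×′≈fromℕ (suc n)))))
    fromℤ-+ -[1+ m ] (+ n)    = trans (fromℤ-⊖ n (suc m)) (trans (+-comm _ _)
      (sym (+-cong (-‿cong (×′≈fromℕ (suc m))) (×′≈fromℕ n))))
    fromℤ-+ -[1+ m ] -[1+ n ] = trans
      (-‿cong (trans (reflexive (≡.cong (λ k → suc k Mult′.× 1#) (≡.sym (ℕ.+-suc m n))))
                     (Mult′.×-homo-+ 1# (suc m) (suc n))))
      (sym (-‿+-comm _ _))

    fromℤ-neg : ∀ i → fromℤ (ℤ.- i) ≈ - fromℤ i
    fromℤ-neg (+ zero)  = sym -0#≈0#
    fromℤ-neg (+ suc n) = refl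
    fromℤ-neg -[1+ n ]  = sym (-‿involutive _)

    fromℤ-+* : ∀ m n → fromℤ (+ m ℤ.* + n) ≈ fromℤ (+ m) * fromℤ (+ n)
    fromℤ-+* m n rewrite ≡.sym (ℤ.pos-* m n) = begin
      (m ℕ.* n) Mult′.× 1#            ≈⟨ ×′≈fromℕ (m ℕ.* n) ⟩
      fromℕ (m ℕ.* n)                 ≈⟨ fromℕ-* m n ⟩
      fromℕ m * fromℕ n               ≈⟨ *-cong (×′≈fromℕ m) (×′≈fromℕ n) ⟨
      (m Mult′.× 1#) * (n Mult′.× 1#) ∎
      where open ≈-Reasoning

    fromℤ-* : ∀ i j → fromℤ (i ℤ.* j) ≈ fromℤ i * fromℤ j
    fromℤ-* (+ m)    (+ n)    = fromℤ-+* m n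
    fromℤ-* (+ m)    -[1+ n ] rewrite ≡.sym (ℤ.neg-distribʳ-* (+ m) (+ suc n)) =
      trans (fromℤ-neg (+ m ℤ.* + suc n)) (trans (-‿cong (fromℤ-+* m (suc n))) (-‿distribʳ-* _ _))
    fromℤ-* -[1+ m ] (+ n)    rewrite ≡.sym (ℤ.neg-distribˡ-* (+ suc m) (+ n)) =
      trans (fromℤ-neg (+ suc m ℤ.* + n)) (trans (-‿cong (fromℤ-+* (suc m) n)) (-‿distribˡ-* _ _))
    fromℤ-* -[1+ m ] -[1+ n ] = trans (fromℤ-+* (suc m) (suc n)) (begin
      x * y          ≈⟨ -‿involutive _ ⟨
      - (- (x * y))  ≈⟨ -‿cong (-‿distribˡ-* x y) ⟩
      - (- x * y)    ≈⟨ -‿distribʳ-* _ _ ⟩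
      - x * - y      ∎)
      where
      open ≈-Reasoning
      x = suc m Mult′.× 1#
      y = suc n Mult′.× 1#

    ℤ⟶ℝ : ℤ.+-*-rawRing -Raw-AlmostCommutative⟶ fromCommutativeRing commutativeRing
    ℤ⟶ℝ = record
      { ⟦_⟧ = fromℤ ; +-homo = fromℤ-+ ; *-homo = fromℤ-* ; -‿homo = fromℤ-neg
      ; 0-homo = refl ; 1-homo = refl }

    _≟ᶜ_ : ∀ i j → Maybe (fromℤ i ≈ fromℤ j)
    i ≟ᶜ j with i ℤ.≟ j
    ... | yes i≡j = just (reflexive (≡.cong fromℤ i≡j))
    ... | no  _   = nothing

  open Algebra.Solver.Ring ℤ.+-*-rawRing (fromCommutativeRing commutativeRing) ℤ⟶ℝ _≟ᶜ_
    using (solve; _:=_; con; _:+_; _:*_; _:-_; :-_)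

  -- Order

  open IsStrictPartialOrder isStrictPartialOrder
    using (<-resp-≈; <-respˡ-≈; <-respʳ-≈)
    renaming (irrefl to <-irrefl; trans to <-trans; asym to <-asym)
  open IsJoinSemilattice isJoinSemilattice
    using (x≤x∨y; y≤x∨y; ∨-least; ≤-respˡ-≈; ≤-respʳ-≈)
    renaming (refl to ≤-refl; reflexive to ≤-reflexive; trans to ≤-trans; antisym to ≤-antisym; isPreorder to ≤-isPreorder)

  <⇒≤ : ∀ {x y} → x < y → x ≤ y
  <⇒≤ = <-asym

  <-≤-trans : ∀ {x y z} → x < y → y ≤ z → x < z
  <-≤-trans {z = z} x<y y≤z = [ id , (λ z<y → contradiction z<y y≤z) ]′ (<-cotrans x<y z)

  ≤-<-trans : ∀ {x y z} → x ≤ y → y < z → x < z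
  ≤-<-trans {x} x≤y y<z = [ (λ y<x → contradiction y<x x≤y) , id ]′ (<-cotrans y<z x)

  module ≤-Reasoning = Relation.Binary.Reasoning.Base.Triple
    ≤-isPreorder <-asym <-trans <-resp-≈ <⇒≤ <-≤-trans ≤-<-trans

  -- As ≤ is a negation, it may be proved by classical case analysis.
  ≤-cases : ∀ x y {u v} → (x ≤ y → u ≤ v) → (y < x → u ≤ v) → u ≤ v
  ≤-cases x y f g v<u = f (λ y<x → g y<x v<u) v<u

  +-monoʳ-< : ∀ {x y} z → x < y → z + x < z + y
  +-monoʳ-< z x<y = <-respˡ-≈ (+-comm _ z) (<-respʳ-≈ (+-comm _ z) (+-monoˡ-< z x<y))

  +-mono-< : ∀ {x y u v} → x < y → u < v → x + u < y + v
  +-mono-< {u = u} x<y u<v = <-trans (+-monoˡ-< u x<y) (+-monoʳ-< _ u<v)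

  +-monoˡ-≤ : ∀ {x y} z → x ≤ y → x + z ≤ y + z
  +-monoˡ-≤ {x} {y} z x≤y y+z<x+z =
    x≤y (<-respˡ-≈ (shift y z) (<-respʳ-≈ (shift x z) (+-monoˡ-< (- z) y+z<x+z)))
    where
    shift : ∀ u v → (u + v) - v ≈ u
    shift = solve 2 (λ u v → (u :+ v) :- v := u) refl

  +-mono-≤ : ∀ {x y u v} → x ≤ y → u ≤ v → x + u ≤ y + v
  +-mono-≤ {y = y} {u} x≤y u≤v = ≤-trans (+-monoˡ-≤ u x≤y)
    (≤-respˡ-≈ (+-comm _ y) (≤-respʳ-≈ (+-comm _ y) (+-monoˡ-≤ y u≤v)))

  x≤y⇒0≤y-x : ∀ {x y} → x ≤ y → 0# ≤ y - x
  x≤y⇒0≤y-x {x} x≤y = ≤-respˡ-≈ (-‿inverseʳ x) (+-monoˡ-≤ (- x) x≤y)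

  x<y⇒0<y-x : ∀ {x y} → x < y → 0# < y - x
  x<y⇒0<y-x {x} x<y = <-respˡ-≈ (-‿inverseʳ x) (+-monoˡ-< (- x) x<y)

  gap-≤ : ∀ {x y e} → 0# ≤ e → x + e ≈ y → x ≤ y
  gap-≤ {x} {e = e} 0≤e x+e≈y =
    ≤-respˡ-≈ (+-identityʳ x) (≤-respʳ-≈ x+e≈y (+-mono-≤ ≤-refl 0≤e))

  gap-< : ∀ {x y e} → 0# < e → x + e ≈ y → x < y
  gap-< {x} 0<e x+e≈y = <-respˡ-≈ (+-identityʳ x) (<-respʳ-≈ x+e≈y (+-monoʳ-< x 0<e))

  -- The axioms multiply only strictly positive elements. A nonnegative factor that is not positive
  -- is zero by antisymmetry, which settles the remaining cases.
  *-nonneg : ∀ {x y} → 0# ≤ x → 0# ≤ y → 0# ≤ x * y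
  *-nonneg {x} {y} 0≤x 0≤y =
    ≤-cases x 0# (λ x≤0 → ≤-reflexive (sym (trans (*-congʳ (≤-antisym x≤0 0≤x)) (zeroˡ y)))) λ 0<x →
    ≤-cases y 0# (λ y≤0 → ≤-reflexive (sym (trans (*-congˡ (≤-antisym y≤0 0≤y)) (zeroʳ x)))) λ 0<y →
    <⇒≤ (*-pos 0<x 0<y)

  *-monoˡ-≤ : ∀ {x y} z → 0# ≤ z → x ≤ y → z * x ≤ z * y
  *-monoˡ-≤ {x} {y} z 0≤z x≤y = gap-≤ (*-nonneg 0≤z (x≤y⇒0≤y-x x≤y))
    (solve 3 (λ x y z → z :* x :+ z :* (y :- x) := z :* y) refl x y z)

  *-monoʳ-≤ : ∀ {x y} z → 0# ≤ z → x ≤ y → x * z ≤ y * z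
  *-monoʳ-≤ z 0≤z x≤y = ≤-respˡ-≈ (*-comm z _) (≤-respʳ-≈ (*-comm z _) (*-monoˡ-≤ z 0≤z x≤y))

  *-mono-≤ : ∀ {x y u v} → 0# ≤ x → 0# ≤ v → x ≤ y → u ≤ v → x * u ≤ y * v
  *-mono-≤ {x} {v = v} 0≤x 0≤v x≤y u≤v = ≤-trans (*-monoˡ-≤ x 0≤x u≤v) (*-monoʳ-≤ v 0≤v x≤y)

  *-monoˡ-< : ∀ {x y} z → 0# < z → x < y → z * x < z * y
  *-monoˡ-< {x} {y} z 0<z x<y = gap-< (*-pos 0<z (x<y⇒0<y-x x<y))
    (solve 3 (λ x y z → z :* x :+ z :* (y :- x) := z :* y) refl x y z)

  ^-nonneg : ∀ {x} n → 0# ≤ x → 0# ≤ x ^ n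
  ^-nonneg zero    0≤x = <⇒≤ 0<1
  ^-nonneg (suc n) 0≤x = *-nonneg 0≤x (^-nonneg n 0≤x)

  ^-mono-≤ : ∀ {x y} n → 0# ≤ x → x ≤ y → x ^ n ≤ y ^ n
  ^-mono-≤ zero    0≤x x≤y = ≤-refl
  ^-mono-≤ (suc n) 0≤x x≤y = *-mono-≤ 0≤x (^-nonneg n (≤-trans 0≤x x≤y)) x≤y (^-mono-≤ n 0≤x x≤y)

  0≤fromℕ : ∀ n → 0# ≤ fromℕ n
  0≤fromℕ zero    = ≤-refl
  0≤fromℕ (suc n) = <⇒≤ (0<fromℕ (suc n))

  fromℕ<fromℕ-suc : ∀ n → fromℕ n < fromℕ (suc n)
  fromℕ<fromℕ-suc n = gap-< 0<1 (+-comm _ _)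

  -- An invertible element is apart from 0, hence has a sign; a negative one would give `1# < 0#`
  -- after multiplication by the positive `fromℕ n`.
  0<recip : ∀ n .{{_ : NonZero n}} → 0# < recip n
  0<recip n = [ (λ r<0 → contradiction (impossible r<0) (<-irrefl refl)) , id ]′ recip#0
    where
    recip#0 : recip n # 0#
    recip#0 = invertible⇒# (fromℕ n , inverseˡ , trans (*-comm _ _) inverseˡ)
      where
      inverseˡ : fromℕ n * (recip n - 0#) ≈ 1#
      inverseˡ = trans (solve 2 (λ x y → x :* (y :- con (+ 0)) := y :* x) refl (fromℕ n) (recip n))
                       (recip-inverse n)
    impossible : recip n < 0# → 0# < 0#
    impossible r<0 = <-trans 0<1 (gap-< (*-pos (x<y⇒0<y-x r<0) (0<fromℕ n)) (begin
      1# + (0# - recip n) * fromℕ n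
        ≈⟨ solve 2 (λ r x → con (+ 1) :+ (con (+ 0) :- r) :* x := con (+ 1) :- r :* x) refl (recip n) (fromℕ n) ⟩
      1# - recip n * fromℕ n
        ≈⟨ +-congˡ (-‿cong (recip-inverse n)) ⟩
      1# - 1#
        ≈⟨ -‿inverseʳ 1# ⟩
      0# ∎))
      where open ≈-Reasoning

  x÷n*n≈x : ∀ x n .{{_ : NonZero n}} → x ÷ n * fromℕ n ≈ x
  x÷n*n≈x x n = trans (*-assoc _ _ _) (trans (*-congˡ (recip-inverse n)) (*-identityʳ x))

  0<x÷n : ∀ {x} n .{{_ : NonZero n}} → 0# < x → 0# < x ÷ n
  0<x÷n n 0<x = *-pos 0<x (0<recip n)

  x<n⇒ε÷n*x<ε : ∀ {x} ε n .{{_ : NonZero n}} → 0# < ε → x < fromℕ n → ε ÷ n * x < ε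
  x<n⇒ε÷n*x<ε ε n 0<ε x<n = <-respʳ-≈ (x÷n*n≈x ε n) (*-monoˡ-< _ (0<x÷n n 0<ε) x<n)

  archimedean⁺ : ∀ x → ∃[ n ] x < fromℕ (suc n)
  archimedean⁺ x with archimedean x
  ... | n , x<n = n , <-trans x<n (fromℕ<fromℕ-suc n)

  half+half : ∀ x → x ÷ 2 + x ÷ 2 ≈ x
  half+half x = trans
    (solve 1 (λ h → h :+ h := h :* (con (+ 1) :+ (con (+ 1) :+ con (+ 0)))) refl (x ÷ 2))
    (x÷n*n≈x x 2)

  -- Cotransitivity compares `x ⊔ y` with both hypotheses. If it does not yield the claim, both `x`
  -- and `y` lie strictly below their join, which is absurd because the join is below the larger of
  -- the two. Strict bounds on `∣ x ∣` are assembled in this way.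
  ⊔-lub-< : ∀ {x y z} → x < z → y < z → x ⊔ y < z
  ⊔-lub-< {x} {y} {z} x<z y<z with <-cotrans x<z (x ⊔ y) | <-cotrans y<z (x ⊔ y)
  ... | inj₂ x⊔y<z | _           = x⊔y<z
  ... | _          | inj₂ x⊔y<z  = x⊔y<z
  ... | inj₁ x<x⊔y | inj₁ y<x⊔y  = contradiction x<x⊔y
    (≤-cases x y (λ x≤y → contradiction y<x⊔y (∨-least x≤y ≤-refl))
                 (λ y<x → ∨-least ≤-refl (<⇒≤ y<x)))

  neg-< : ∀ {x y} → x < y → - y < - x
  neg-< {x} {y} x<y = gap-< (x<y⇒0<y-x x<y) (solve 2 (λ x y → :- y :+ (y :- x) := :- x) refl x y)

  -- The structure provides joins only, so the minimum is a negated join of negatives. It selects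
  -- one mesh that serves two integrals.
  min-bound : ∀ {x y} → 0# < x → 0# < y → ∃[ z ] 0# < z ∧ z ≤ x ∧ z ≤ y
  min-bound {x} {y} 0<x 0<y = - (- x ⊔ - y)
    , <-respˡ-≈ -0≈0 (neg-< (⊔-lub-< (<-respʳ-≈ -0≈0 (neg-< 0<x)) (<-respʳ-≈ -0≈0 (neg-< 0<y))))
    , below (x≤x∨y _ _) , below (y≤x∨y _ _)
    where
    -0≈0 : - 0# ≈ 0#
    -0≈0 = solve 0 (:- con (+ 0) := con (+ 0)) refl
    below : ∀ {u w} → - u ≤ w → - w ≤ u
    below {u} {w} -u≤w = gap-≤ (x≤y⇒0≤y-x -u≤w)
      (solve 2 (λ u w → :- w :+ (w :- :- u) := u) refl u w)

  ∣x∣<ε⇒x<ε : ∀ {x ε} → ∣ x ∣ < ε → x < ε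
  ∣x∣<ε⇒x<ε {x} = ≤-<-trans (x≤x∨y x (- x))

  ∣x∣<ε⇒-x<ε : ∀ {x ε} → ∣ x ∣ < ε → - x < ε
  ∣x∣<ε⇒-x<ε {x} = ≤-<-trans (y≤x∨y x (- x))

  -- The Riemann integral

  riemannSum-+ : ∀ {x y} f g (p : TaggedPartition x y) →
    riemannSum (λ θ → f θ + g θ) p ≈ riemannSum f p + riemannSum g p
  riemannSum-+ f g (end _) = sym (+-identityˡ 0#)
  riemannSum-+ {x} f g (cell t z _ _ p) = trans (+-congˡ (riemannSum-+ f g p))
    (solve 5 (λ u v w s r → (u :+ v) :* w :+ (s :+ r) := (u :* w :+ s) :+ (v :* w :+ r)) refl
      (f t) (g t) (z - x) (riemannSum f p) (riemannSum g p))

  riemannSum-*ˡ : ∀ {x y} k f (p : TaggedPartition x y) →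
    riemannSum (λ θ → k * f θ) p ≈ k * riemannSum f p
  riemannSum-*ˡ k f (end _) = sym (zeroʳ k)
  riemannSum-*ˡ {x} k f (cell t z _ _ p) = trans (+-congˡ (riemannSum-*ˡ k f p))
    (solve 4 (λ k u w s → k :* u :* w :+ k :* s := k :* (u :* w :+ s)) refl k (f t) (z - x) (riemannSum f p))

  partition-≤ : ∀ {x y} → TaggedPartition x y → x ≤ y
  partition-≤ (end x≈y)          = ≤-reflexive x≈y
  partition-≤ (cell t z x≤t t≤z p) = ≤-trans (≤-trans x≤t t≤z) (partition-≤ p)

  -- Tags lie between the endpoints, and `partition-≤` bounds them by the right one; integrands
  -- therefore need to agree on the interval only.
  riemannSum-cong : ∀ {x y f g} → (∀ θ → x ≤ θ → θ ≤ y → f θ ≈ g θ) →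
    (p : TaggedPartition x y) → riemannSum f p ≈ riemannSum g p
  riemannSum-cong f≈g (end _) = refl
  riemannSum-cong f≈g (cell t z x≤t t≤z p) = +-cong
    (*-congʳ (f≈g t x≤t (≤-trans t≤z (partition-≤ p))))
    (riemannSum-cong (λ θ z≤θ → f≈g θ (≤-trans (≤-trans x≤t t≤z) z≤θ)) p)

  FinerThan-mono : ∀ {δ δ′ x y} {p : TaggedPartition x y} → δ ≤ δ′ → FinerThan δ p → FinerThan δ′ p
  FinerThan-mono δ≤δ′ end            = end
  FinerThan-mono δ≤δ′ (cell z-x<δ fp) = cell (<-≤-trans z-x<δ δ≤δ′) (FinerThan-mono δ≤δ′ fp)

  ∣∣<-resp-≈ : ∀ {x y ε} → x ≈ y → ∣ x ∣ < ε → ∣ y ∣ < ε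
  ∣∣<-resp-≈ x≈y ∣x∣<ε =
    ⊔-lub-< (<-respˡ-≈ x≈y (∣x∣<ε⇒x<ε ∣x∣<ε)) (<-respˡ-≈ (-‿cong x≈y) (∣x∣<ε⇒-x<ε ∣x∣<ε))

  integral-cong : ∀ {x y f g I J} → (∀ θ → x ≤ θ → θ ≤ y → f θ ≈ g θ) → I ≈ J →
    IsIntegral x y f I → IsIntegral x y g J
  integral-cong f≈g I≈J ∫f ε 0<ε =
    let δ , 0<δ , close = ∫f ε 0<ε
    in δ , 0<δ , λ p fp → ∣∣<-resp-≈ (+-cong (riemannSum-cong f≈g p) (-‿cong I≈J)) (close p fp)

  private
    ∣∣<-+ : ∀ {x y} ε → ∣ x ∣ < ε ÷ 2 → ∣ y ∣ < ε ÷ 2 → ∣ x + y ∣ < ε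
    ∣∣<-+ {x} {y} ε ∣x∣<ε ∣y∣<ε = <-respʳ-≈ (half+half ε) (⊔-lub-<
      (+-mono-< (∣x∣<ε⇒x<ε ∣x∣<ε) (∣x∣<ε⇒x<ε ∣y∣<ε))
      (<-respˡ-≈ (solve 2 (λ x y → :- x :+ :- y := :- (x :+ y)) refl x y)
        (+-mono-< (∣x∣<ε⇒-x<ε ∣x∣<ε) (∣x∣<ε⇒-x<ε ∣y∣<ε))))

    rearrange-differences : ∀ s i t j → (s - i) + (t - j) ≈ (s + t) - (i + j)
    rearrange-differences = solve 4 (λ s i t j → (s :- i) :+ (t :- j) := (s :+ t) :- (i :+ j)) refl

  integral-+ : ∀ {x y f g I J} → IsIntegral x y f I → IsIntegral x y g J →
    IsIntegral x y (λ θ → f θ + g θ) (I + J)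
  integral-+ {f = f} {g} {I} {J} ∫f ∫g ε 0<ε =
    let δ₁ , 0<δ₁ , close₁ = ∫f (ε ÷ 2) (0<x÷n 2 0<ε)
        δ₂ , 0<δ₂ , close₂ = ∫g (ε ÷ 2) (0<x÷n 2 0<ε)
        δ , 0<δ , δ≤δ₁ , δ≤δ₂ = min-bound 0<δ₁ 0<δ₂
    in δ , 0<δ , λ p fp → ∣∣<-resp-≈
      (trans (rearrange-differences (riemannSum f p) I (riemannSum g p) J)
             (+-congʳ (sym (riemannSum-+ f g p))))
      (∣∣<-+ ε (close₁ p (FinerThan-mono δ≤δ₁ fp)) (close₂ p (FinerThan-mono δ≤δ₂ fp)))

  private
    -- The sign of `k` is decided by cases, which is legitimate only because the conclusion is weak.
    -- Strictness is recovered where the bound is applied.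
    k*d≤η*n : ∀ {k d η n} → 0# < η → k < n → - k < n → d < η → - d < η → k * d ≤ η * n
    k*d≤η*n {k} {d} {η} {n} 0<η k<n -k<n d<η -d<η = ≤-cases 0# k
      (λ 0≤k → ≤-trans (*-monoˡ-≤ k 0≤k (<⇒≤ d<η)) (≤-respˡ-≈ (*-comm η k) (*-monoˡ-≤ η (<⇒≤ 0<η) (<⇒≤ k<n))))
      (λ k<0 → begin
        k * d    ≈⟨ solve 2 (λ k d → k :* d := :- k :* :- d) refl k d ⟩
        - k * - d ≤⟨ *-monoˡ-≤ (- k) (0≤-k k<0) (<⇒≤ -d<η) ⟩
        - k * η  ≈⟨ *-comm _ _ ⟩
        η * - k  ≤⟨ *-monoˡ-≤ η (<⇒≤ 0<η) (<⇒≤ -k<n) ⟩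
        η * n    ∎)
      where
      open ≤-Reasoning
      0≤-k : k < 0# → 0# ≤ - k
      0≤-k k<0 = ≤-respʳ-≈ (+-identityˡ _) (x≤y⇒0≤y-x (<⇒≤ k<0))

    ∣∣<-* : ∀ {d} k ε n → 0# < ε → ∣ k ∣ < fromℕ (suc n) → ∣ d ∣ < ε ÷ suc (suc n) → ∣ k * d ∣ < ε
    ∣∣<-* {d} k ε n 0<ε ∣k∣<n ∣d∣<η = ⊔-lub-<
      (≤-<-trans (k*d≤η*n 0<η (∣x∣<ε⇒x<ε ∣k∣<n) (∣x∣<ε⇒-x<ε ∣k∣<n) d<η -d<η) η*n<ε)
      (<-respˡ-≈ (solve 2 (λ k d → k :* :- d := :- (k :* d)) refl k d)
        (≤-<-trans (k*d≤η*n 0<η (∣x∣<ε⇒x<ε ∣k∣<n) (∣x∣<ε⇒-x<ε ∣k∣<n) -d<η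
          (<-respˡ-≈ (solve 1 (λ d → d := :- (:- d)) refl d) d<η)) η*n<ε))
      where
      0<η = 0<x÷n (suc (suc n)) 0<ε
      d<η = ∣x∣<ε⇒x<ε ∣d∣<η
      -d<η = ∣x∣<ε⇒-x<ε ∣d∣<η
      -- Dividing `ε` by one more than the bound on `∣ k ∣` leaves the slack that turns the weak
      -- product bound into a strict one.
      η*n<ε = x<n⇒ε÷n*x<ε ε (suc (suc n)) 0<ε (fromℕ<fromℕ-suc (suc n))

    *-distribˡ-difference : ∀ k s i → k * (s - i) ≈ k * s - k * i
    *-distribˡ-difference = solve 3 (λ k s i → k :* (s :- i) := k :* s :- k :* i) refl

  integral-*ˡ : ∀ {x y f I} k → IsIntegral x y f I → IsIntegral x y (λ θ → k * f θ) (k * I)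
  integral-*ˡ {f = f} {I} k ∫f ε 0<ε =
    let n , ∣k∣<1+n = archimedean⁺ ∣ k ∣
        δ , 0<δ , close = ∫f (ε ÷ suc (suc n)) (0<x÷n (suc (suc n)) 0<ε)
    in δ , 0<δ , λ p fp → ∣∣<-resp-≈
      (trans (*-distribˡ-difference k (riemannSum f p) I) (+-congʳ (sym (riemannSum-*ˡ k f p))))
      (∣∣<-* k ε n 0<ε ∣k∣<1+n (close p fp))

  integral-0 : ∀ {x y} → IsIntegral x y (λ _ → 0#) 0#
  integral-0 ε 0<ε = 1# , 0<1 , λ p _ →
    ⊔-lub-< (<-respˡ-≈ (S-0≈0 p) 0<ε) (<-respˡ-≈ (0-S≈0 p) 0<ε)
    where
    S≈0 : ∀ {x y} (p : TaggedPartition x y) → riemannSum (λ _ → 0#) p ≈ 0#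
    S≈0 (end _)          = refl
    S≈0 (cell _ _ _ _ p) = trans (+-cong (zeroˡ _) (S≈0 p)) (+-identityˡ 0#)
    S-0≈0 : ∀ {x y} (p : TaggedPartition x y) → 0# ≈ riemannSum (λ _ → 0#) p - 0#
    S-0≈0 p = sym (trans (+-congʳ (S≈0 p)) (-‿inverseʳ 0#))
    0-S≈0 : ∀ {x y} (p : TaggedPartition x y) → 0# ≈ - (riemannSum (λ _ → 0#) p - 0#)
    0-S≈0 p = trans (solve 0 (con (+ 0) := :- con (+ 0)) refl) (-‿cong (S-0≈0 p))

  integral-sum : ∀ {x y} n {f : ℕ → ℝ → ℝ} {I : ℕ → ℝ} →
    (∀ k → k ℕ.< n → IsIntegral x y (f k) (I k)) →
    IsIntegral x y (λ θ → ∑[ k < n ] f k θ) (∑[ k < n ] I k)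
  integral-sum zero    ∫f = integral-0
  integral-sum (suc n) ∫f = integral-+ (∫f 0 (s≤s z≤n)) (integral-sum n (λ k k<n → ∫f (suc k) (s≤s k<n)))

  -- Fine partitions and uniqueness of integrals on [0 , 1]

  uniformPartition : ∀ {x y δ} h n → 0# ≤ h → h < δ → x + fromℕ n * h ≈ y →
    ∃[ p ] FinerThan δ {x} {y} p
  uniformPartition {x} h zero 0≤h h<δ x+nh≈y =
    end (trans (solve 2 (λ x h → x := x :+ con (+ 0) :* h) refl x h) x+nh≈y) , end
  uniformPartition {x} h (suc n) 0≤h h<δ x+nh≈y with uniformPartition {x + h} h n 0≤h h<δ
    (trans (solve 3 (λ x n h → (x :+ h) :+ n :* h := x :+ (con (+ 1) :+ n) :* h) refl x (fromℕ n) h) x+nh≈y)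
  ... | p , fp = cell x (x + h) ≤-refl (gap-≤ 0≤h refl) p
               , cell (<-respˡ-≈ (solve 2 (λ x h → h := (x :+ h) :- x) refl x h) h<δ) fp

  -- By the Archimedean axiom some `suc n` exceeds the inverse `d` of `δ`, and then `suc n` equal
  -- cells are short enough. Without such partitions `IsIntegral` would hold vacuously for every
  -- value.
  finePartition : ∀ δ → 0# < δ → ∃[ p ] FinerThan δ {0#} {1#} p
  finePartition δ 0<δ with #⇒invertible {δ} {0#} (inj₂ 0<δ)
  ... | d , d*δ≈1 , _ with archimedean⁺ d
  ... | n , d<n = uniformPartition (recip (suc n)) (suc n) (<⇒≤ (0<recip (suc n))) r<δ
    (trans (+-identityˡ _) (trans (*-comm _ _) (recip-inverse (suc n))))
    where
    open ≤-Reasoning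
    r = recip (suc n)
    r<δ : r < δ
    r<δ = begin-strict
      r                    ≈⟨ *-identityʳ r ⟨
      r * 1#               ≈⟨ *-congˡ d*δ≈1 ⟨
      r * (d * (δ - 0#))   ≈⟨ solve 3 (λ r d δ → r :* (d :* (δ :- con (+ 0))) := (r :* δ) :* d) refl r d δ ⟩
      (r * δ) * d          <⟨ *-monoˡ-< (r * δ) (*-pos (0<recip (suc n)) 0<δ) d<n ⟩
      (r * δ) * fromℕ (suc n)  ≈⟨ solve 3 (λ r δ n → (r :* δ) :* n := δ :* (r :* n)) refl r δ (fromℕ (suc n)) ⟩
      δ * (r * fromℕ (suc n))  ≈⟨ *-congˡ (recip-inverse (suc n)) ⟩
      δ * 1#               ≈⟨ *-identityʳ δ ⟩
      δ ∎

  -- As `≤` is a negation, a gap `J < I` may be assumed. One partition fine enough for both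
  -- integrals at half the gap yields `I - J < I - J`.
  integral-≤ : ∀ {f I J} → IsIntegral 0# 1# f I → IsIntegral 0# 1# f J → I ≤ J
  integral-≤ {f} {I} {J} ∫I ∫J J<I =
    let ε = (I - J) ÷ 2
        0<ε = 0<x÷n 2 (x<y⇒0<y-x J<I)
        δ₁ , 0<δ₁ , close₁ = ∫I ε 0<ε
        δ₂ , 0<δ₂ , close₂ = ∫J ε 0<ε
        δ , 0<δ , δ≤δ₁ , δ≤δ₂ = min-bound 0<δ₁ 0<δ₂
        p , fp = finePartition δ 0<δ
        S = riemannSum f p
    in <-irrefl refl (begin-strict
      I - J
        ≈⟨ solve 3 (λ i j s → i :- j := :- (s :- i) :+ (s :- j)) refl I J S ⟩
      - (S - I) + (S - J)
        <⟨ +-mono-< (∣x∣<ε⇒-x<ε (close₁ p (FinerThan-mono δ≤δ₁ fp)))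
                    (∣x∣<ε⇒x<ε (close₂ p (FinerThan-mono δ≤δ₂ fp))) ⟩
      ε + ε
        ≈⟨ half+half (I - J) ⟩
      I - J ∎)
    where open ≤-Reasoning

  integral-unique : ∀ {f I J} → IsIntegral 0# 1# f I → IsIntegral 0# 1# f J → I ≈ J
  integral-unique ∫I ∫J = ≤-antisym (integral-≤ ∫I ∫J) (integral-≤ ∫J ∫I)

  -- The bounds on F say that F is a primitive of f; they make the error of a
  -- Riemann sum on each cell at most the mesh times the increment of f, which
  -- telescopes.
  integral-of-monotone : ∀ {x y} {f F : ℝ → ℝ} →
    (∀ {u v} → x ≤ u → u ≤ v → v ≤ y → f u ≤ f v) →
    (∀ {u v} → x ≤ u → u ≤ v → v ≤ y → f u * (v - u) ≤ F v - F u) →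
    (∀ {u v} → x ≤ u → u ≤ v → v ≤ y → F v - F u ≤ f v * (v - u)) →
    IsIntegral x y f (F y - F x)
  integral-of-monotone {x} {y} {f} {F} mono lower upper ε 0<ε with archimedean⁺ (f y - f x)
  ... | n , Δf<n = δ , 0<δ , λ p fp →
    let above , below = error ≤-refl p fp
    in ⊔-lub-< (≤-<-trans above δΔf<ε)
         (≤-<-trans (≤-respˡ-≈ (solve 2 (λ s t → s :- t := :- (t :- s)) refl _ _) below) δΔf<ε)
    where
    δ = ε ÷ suc n
    0<δ = 0<x÷n (suc n) 0<ε
    δΔf<ε = x<n⇒ε÷n*x<ε ε (suc n) 0<ε Δf<n
    error : ∀ {u} → x ≤ u → (p : TaggedPartition u y) → FinerThan δ p →
      riemannSum f p - (F y - F u) ≤ δ * (f y - f u) ∧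
      (F y - F u) - riemannSum f p ≤ δ * (f y - f u)
    -- `f` and `F` are not assumed to respect `≈`, so `u ≈ y` does not give `F u ≈ F y` by
    -- congruence; both inequalities come from the bounds on `F`, whose factor `y - u` vanishes.
    error {u} x≤u (end u≈y) end = ≤-trans -ΔF≤0 0≤δΔf
                                , ≤-trans (≤-respˡ-≈ (solve 1 (λ t → t := t :- con (+ 0)) refl _) ΔF≤0) 0≤δΔf
      where
      u≤y = ≤-reflexive u≈y
      0≤δΔf : 0# ≤ δ * (f y - f u)
      0≤δΔf = *-nonneg (<⇒≤ 0<δ) (x≤y⇒0≤y-x (mono x≤u u≤y ≤-refl))
      y-u≈0 : y - u ≈ 0#
      y-u≈0 = trans (+-congˡ (-‿cong u≈y)) (-‿inverseʳ y)
      ΔF≤0 : F y - F u ≤ 0#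
      ΔF≤0 = ≤-respʳ-≈ (trans (*-congˡ y-u≈0) (zeroʳ _)) (upper x≤u u≤y ≤-refl)
      -ΔF≤0 : 0# + - (F y - F u) ≤ 0#
      -ΔF≤0 = gap-≤ (≤-respˡ-≈ (trans (*-congˡ y-u≈0) (zeroʳ _)) (lower x≤u u≤y ≤-refl))
        (solve 1 (λ t → (con (+ 0) :+ :- t) :+ t := con (+ 0)) refl _)
    error {u} x≤u (cell t z u≤t t≤z p) (cell z-u<δ fp) with error (≤-trans x≤u (≤-trans u≤t t≤z)) p fp
    ... | above , below = (begin
        (f t * (z - u) + S) - (F y - F u)
          ≈⟨ solve 5 (λ a s y z u → (a :+ s) :- (y :- u) := (a :- (z :- u)) :+ (s :- (y :- z))) refl _ S (F y) (F z) (F u) ⟩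
        (f t * (z - u) - (F z - F u)) + (S - (F y - F z))
          ≤⟨ +-mono-≤ (≤-trans (+-mono-≤ ft≤fz (neg-≤ (lower x≤u u≤z z≤y))) cell≤) above ⟩
        δ * (f z - f u) + δ * (f y - f z)
          ≈⟨ join ⟩
        δ * (f y - f u) ∎) , (begin
        (F y - F u) - (f t * (z - u) + S)
          ≈⟨ solve 5 (λ a s y z u → (y :- u) :- (a :+ s) := ((z :- u) :- a) :+ ((y :- z) :- s)) refl _ S (F y) (F z) (F u) ⟩
        ((F z - F u) - f t * (z - u)) + ((F y - F z) - S)
          ≤⟨ +-mono-≤ (≤-trans (+-mono-≤ (upper x≤u u≤z z≤y) (neg-≤ fu≤ft)) cell≤) below ⟩
        δ * (f z - f u) + δ * (f y - f z)
          ≈⟨ join ⟩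
        δ * (f y - f u) ∎)
      where
      open ≤-Reasoning
      S = riemannSum f p
      u≤z = ≤-trans u≤t t≤z
      z≤y = partition-≤ p
      0≤z-u = x≤y⇒0≤y-x u≤z
      neg-≤ : ∀ {v w} → v ≤ w → - w ≤ - v
      neg-≤ v≤w = gap-≤ (x≤y⇒0≤y-x v≤w) (solve 2 (λ v w → :- w :+ (w :- v) := :- v) refl _ _)
      ft≤fz : f t * (z - u) ≤ f z * (z - u)
      ft≤fz = *-monoʳ-≤ _ 0≤z-u (mono (≤-trans x≤u u≤t) t≤z z≤y)
      fu≤ft : f u * (z - u) ≤ f t * (z - u)
      fu≤ft = *-monoʳ-≤ _ 0≤z-u (mono x≤u u≤t (≤-trans t≤z z≤y))
      cell≤ : f z * (z - u) - f u * (z - u) ≤ δ * (f z - f u)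
      cell≤ = ≤-respˡ-≈ (solve 3 (λ p q r → r :* (p :- q) := p :* r :- q :* r) refl (f z) (f u) (z - u))
        (*-monoʳ-≤ _ (x≤y⇒0≤y-x (mono x≤u u≤z z≤y)) (<⇒≤ z-u<δ))
      join : δ * (f z - f u) + δ * (f y - f z) ≈ δ * (f y - f u)
      join = solve 4 (λ d p q r → d :* (q :- r) :+ d :* (p :- q) := d :* (p :- r)) refl δ (f y) (f z) (f u)

  -- Integrals of truncated powers

  -- By antisymmetry an equation is a pair of negated statements, so classical case analysis extends
  -- to `≈`.
  ≈-cases : ∀ x y {u v} → (x ≤ y → u ≈ v) → (y < x → u ≈ v) → u ≈ v
  ≈-cases x y f g = ≤-antisym
    (≤-cases x y (≤-reflexive ∘ f) (≤-reflexive ∘ g))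
    (≤-cases x y (≤-reflexive ∘ sym ∘ f) (≤-reflexive ∘ sym ∘ g))

  x≤x₊ : ∀ x → x ≤ x ₊
  x≤x₊ x = x≤x∨y x 0#

  0≤x₊ : ∀ x → 0# ≤ x ₊
  0≤x₊ x = y≤x∨y x 0#

  0≤x⇒x₊≈x : ∀ {x} → 0# ≤ x → x ₊ ≈ x
  0≤x⇒x₊≈x {x} 0≤x = ≤-antisym (∨-least ≤-refl 0≤x) (x≤x₊ x)

  x≤0⇒x₊≈0 : ∀ {x} → x ≤ 0# → x ₊ ≈ 0#
  x≤0⇒x₊≈0 {x} x≤0 = ≤-antisym (∨-least x≤0 ≤-refl) (0≤x₊ x)

  ₊-mono-≤ : ∀ {x y} → x ≤ y → x ₊ ≤ y ₊
  ₊-mono-≤ {y = y} x≤y = ∨-least (≤-trans x≤y (x≤x₊ y)) (0≤x₊ y)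

  -- For q = 0 the junk value 0 ^ 0 = 1 makes (θ - κ)₊ ^ q nonzero to the left of κ.
  Truncates : ℝ → ℝ → ℕ → Set ℓ₂
  Truncates κ x q = κ ≤ x ⊎ 1 ℕ.≤ q

  -- Left of the knot a positive power vanishes and hides the difference between `θ - κ` and its
  -- positive part; for exponent 0 the knot is required to lie left of the interval.
  ₊^-absorb : ∀ {κ x θ} q → Truncates κ x q → x ≤ θ →
    (θ - κ) ₊ ^ q * (θ - κ) ≈ (θ - κ) ₊ ^ q * (θ - κ) ₊
  ₊^-absorb {κ} {x} {θ} q (inj₁ κ≤x) x≤θ =
    *-congˡ (sym (0≤x⇒x₊≈x (x≤y⇒0≤y-x (≤-trans κ≤x x≤θ))))
  ₊^-absorb {κ} {x} {θ} (suc q) (inj₂ _) x≤θ = ≈-cases (θ - κ) 0#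
    (λ d≤0 → trans (vanishes d≤0 _) (sym (vanishes d≤0 _)))
    (λ 0<d → *-congˡ (sym (0≤x⇒x₊≈x (<⇒≤ 0<d))))
    where
    vanishes : θ - κ ≤ 0# → ∀ y → (θ - κ) ₊ ^ suc q * y ≈ 0#
    vanishes d≤0 y = trans (*-congʳ (trans (*-congʳ (x≤0⇒x₊≈0 d≤0)) (zeroˡ _))) (zeroˡ y)

  power-difference : ∀ u v p →
    v ^ suc (suc p) - u ^ suc (suc p) ≈ v * (v ^ suc p - u ^ suc p) + u ^ suc p * (v - u)
  power-difference u v p = solve 4
    (λ u v x y → v :* y :- u :* x := v :* (y :- x) :+ x :* (v :- u)) refl u v (u ^ suc p) (v ^ suc p)

  -- A mean value estimate without derivatives, by induction on `p` through the product rule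
  -- `power-difference`. Together with the upper estimate it makes `x ^ suc p ÷ suc p` a primitive
  -- in the sense of `integral-of-monotone`.
  power-difference-lower : ∀ {u v} p → 0# ≤ u → u ≤ v →
    fromℕ (suc p) * (u ^ p * (v - u)) ≤ v ^ suc p - u ^ suc p
  power-difference-lower {u} {v} zero 0≤u u≤v = ≤-reflexive
    (solve 2 (λ u v → (con (+ 1) :+ con (+ 0)) :* (con (+ 1) :* (v :- u)) := v :* con (+ 1) :- u :* con (+ 1))
      refl u v)
  power-difference-lower {u} {v} (suc p) 0≤u u≤v = begin
    fromℕ (suc (suc p)) * (u ^ suc p * (v - u))
      ≈⟨ solve 4 (λ n u w d → (con (+ 1) :+ n) :* ((u :* w) :* d) := u :* (n :* (w :* d)) :+ (u :* w) :* d)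
           refl (fromℕ (suc p)) u (u ^ p) (v - u) ⟩
    u * lower + u ^ suc p * (v - u)
      ≤⟨ +-mono-≤ (*-mono-≤ 0≤u 0≤Δ u≤v IH) ≤-refl ⟩
    v * (v ^ suc p - u ^ suc p) + u ^ suc p * (v - u)
      ≈⟨ power-difference u v p ⟨
    v ^ suc (suc p) - u ^ suc (suc p) ∎
    where
    open ≤-Reasoning
    lower = fromℕ (suc p) * (u ^ p * (v - u))
    IH = power-difference-lower p 0≤u u≤v
    0≤Δ = x≤y⇒0≤y-x (^-mono-≤ (suc p) 0≤u u≤v)

  power-difference-upper : ∀ {u v} p → 0# ≤ u → u ≤ v →
    v ^ suc p - u ^ suc p ≤ fromℕ (suc p) * (v ^ p * (v - u))
  power-difference-upper {u} {v} zero 0≤u u≤v = ≤-reflexive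
    (solve 2 (λ u v → v :* con (+ 1) :- u :* con (+ 1) := (con (+ 1) :+ con (+ 0)) :* (con (+ 1) :* (v :- u)))
      refl u v)
  power-difference-upper {u} {v} (suc p) 0≤u u≤v = begin
    v ^ suc (suc p) - u ^ suc (suc p)
      ≈⟨ power-difference u v p ⟩
    v * (v ^ suc p - u ^ suc p) + u ^ suc p * (v - u)
      ≤⟨ +-mono-≤ (*-monoˡ-≤ v (≤-trans 0≤u u≤v) (power-difference-upper p 0≤u u≤v))
                  (*-monoʳ-≤ (v - u) (x≤y⇒0≤y-x u≤v) (^-mono-≤ (suc p) 0≤u u≤v)) ⟩
    v * (fromℕ (suc p) * (v ^ p * (v - u))) + v ^ suc p * (v - u)
      ≈⟨ solve 4 (λ n u w d → (con (+ 1) :+ n) :* ((u :* w) :* d) := u :* (n :* (w :* d)) :+ (u :* w) :* d)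
           refl (fromℕ (suc p)) v (v ^ p) (v - u) ⟨
    fromℕ (suc (suc p)) * (v ^ suc p * (v - u)) ∎
    where open ≤-Reasoning

  [n*x]÷n≈x : ∀ n .{{_ : NonZero n}} x → fromℕ n * x ÷ n ≈ x
  [n*x]÷n≈x n x = trans (solve 3 (λ n x r → (n :* x) :* r := x :* (r :* n)) refl (fromℕ n) x (recip n))
                        (trans (*-congˡ (recip-inverse n)) (*-identityʳ x))

  ÷-monoˡ-≤ : ∀ n .{{_ : NonZero n}} {x y} → x ≤ y → x ÷ n ≤ y ÷ n
  ÷-monoˡ-≤ n = *-monoʳ-≤ (recip n) (<⇒≤ (0<recip n))

  ÷-distrib-difference : ∀ x y r → (x - y) * r ≈ x * r - y * r
  ÷-distrib-difference = solve 3 (λ x y r → (x :- y) :* r := x :* r :- y :* r) refl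

  integral-₊^ : ∀ {κ x y} q → Truncates κ x q →
    IsIntegral x y (λ θ → (θ - κ) ₊ ^ q) ((y - κ) ₊ ^ suc q ÷ suc q - (x - κ) ₊ ^ suc q ÷ suc q)
  integral-₊^ {κ} {x} {y} q trunc =
    integral-of-monotone {F = λ θ → (θ - κ) ₊ ^ suc q ÷ suc q} mono lower upper
    where
    open ≤-Reasoning
    shift-mono : ∀ {u v} → u ≤ v → (u - κ) ₊ ≤ (v - κ) ₊
    shift-mono u≤v = ₊-mono-≤ (+-monoˡ-≤ (- κ) u≤v)
    mono : ∀ {u v} → x ≤ u → u ≤ v → v ≤ y → (u - κ) ₊ ^ q ≤ (v - κ) ₊ ^ q
    mono _ u≤v _ = ^-mono-≤ q (0≤x₊ _) (shift-mono u≤v)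
    lower : ∀ {u v} → x ≤ u → u ≤ v → v ≤ y →
      (u - κ) ₊ ^ q * (v - u) ≤ (v - κ) ₊ ^ suc q ÷ suc q - (u - κ) ₊ ^ suc q ÷ suc q
    lower {u} {v} x≤u u≤v _ = begin
      U ^ q * (v - u)
        ≈⟨ solve 4 (λ w u v k → w :* (v :- u) := w :* (v :- k) :- w :* (u :- k)) refl (U ^ q) u v κ ⟩
      U ^ q * (v - κ) - U ^ q * (u - κ)
        -- Here `trunc` enters: with `q = 0` and `u` left of `κ`, the power would be 1 and `u - κ`
        -- could not be exchanged for `U`.
        ≈⟨ +-congˡ (-‿cong (₊^-absorb q trunc x≤u)) ⟩
      U ^ q * (v - κ) - U ^ q * U
        ≤⟨ +-monoˡ-≤ _ (*-monoˡ-≤ (U ^ q) (^-nonneg q (0≤x₊ _)) (x≤x₊ (v - κ))) ⟩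
      U ^ q * V - U ^ q * U
        ≈⟨ solve 3 (λ w u v → w :* v :- w :* u := w :* (v :- u)) refl (U ^ q) U V ⟩
      U ^ q * (V - U)
        ≈⟨ [n*x]÷n≈x (suc q) _ ⟨
      fromℕ (suc q) * (U ^ q * (V - U)) ÷ suc q
        ≤⟨ ÷-monoˡ-≤ (suc q) (power-difference-lower q (0≤x₊ _) (shift-mono u≤v)) ⟩
      (V ^ suc q - U ^ suc q) ÷ suc q
        ≈⟨ ÷-distrib-difference _ _ _ ⟩
      V ^ suc q ÷ suc q - U ^ suc q ÷ suc q ∎
      where
      U = (u - κ) ₊
      V = (v - κ) ₊
    upper : ∀ {u v} → x ≤ u → u ≤ v → v ≤ y →
      (v - κ) ₊ ^ suc q ÷ suc q - (u - κ) ₊ ^ suc q ÷ suc q ≤ (v - κ) ₊ ^ q * (v - u)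
    upper {u} {v} _ u≤v _ = begin
      V ^ suc q ÷ suc q - U ^ suc q ÷ suc q
        ≈⟨ ÷-distrib-difference _ _ _ ⟨
      (V ^ suc q - U ^ suc q) ÷ suc q
        ≤⟨ ÷-monoˡ-≤ (suc q) (power-difference-upper q (0≤x₊ _) (shift-mono u≤v)) ⟩
      fromℕ (suc q) * (V ^ q * (V - U)) ÷ suc q
        ≈⟨ [n*x]÷n≈x (suc q) _ ⟩
      V ^ q * (V - U)
        ≤⟨ *-monoˡ-≤ (V ^ q) (^-nonneg q (0≤x₊ _)) V-U≤v-u ⟩
      V ^ q * (v - u) ∎
      where
      U = (u - κ) ₊
      V = (v - κ) ₊
      0≤v-u = x≤y⇒0≤y-x u≤v
      -- The positive part is 1-Lipschitz; a join is bounded by bounding each of its arguments.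
      V≤ : V ≤ U + (v - u)
      V≤ = ∨-least
        (≤-respˡ-≈ (solve 3 (λ u v k → (u :- k) :+ (v :- u) := v :- k) refl u v κ)
          (+-monoˡ-≤ (v - u) (x≤x₊ (u - κ))))
        (≤-respˡ-≈ (+-identityˡ 0#) (+-mono-≤ (0≤x₊ _) 0≤v-u))
      V-U≤v-u : V - U ≤ v - u
      V-U≤v-u = ≤-respʳ-≈ (solve 2 (λ u d → (u :+ d) :- u := d) refl U (v - u)) (+-monoˡ-≤ (- U) V≤)

  -- ∫₀ᴹ θᵏ (θ - κ)₊^q dθ, computed by expanding one factor θ as (θ - κ) + κ.
  truncatedMoment : ℝ → ℝ → ℕ → ℕ → ℝ
  truncatedMoment M κ zero    q = (M - κ) ^ suc q ÷ suc q
  truncatedMoment M κ (suc k) q = truncatedMoment M κ k (suc q) + κ * truncatedMoment M κ k q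

  -- `0# ≤ κ` makes the contribution of the lower endpoint vanish and `κ ≤ M` removes the positive
  -- part at the upper one, so the value is a polynomial in `κ`. In the recursion the branch with
  -- `suc q` satisfies `Truncates` through its positive exponent.
  integral-truncatedMoment : ∀ {M κ} k q → 0# ≤ κ → κ ≤ M → Truncates κ 0# q →
    IsIntegral 0# M (λ θ → θ ^ k * (θ - κ) ₊ ^ q) (truncatedMoment M κ k q)
  integral-truncatedMoment {M} {κ} zero q 0≤κ κ≤M trunc =
    integral-cong (λ θ _ _ → sym (*-identityˡ _)) value (integral-₊^ q trunc)
    where
    open ≈-Reasoning
    value : (M - κ) ₊ ^ suc q ÷ suc q - (0# - κ) ₊ ^ suc q ÷ suc q ≈ (M - κ) ^ suc q ÷ suc q
    value = begin
      (M - κ) ₊ ^ suc q ÷ suc q - (0# - κ) ₊ ^ suc q ÷ suc q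
        ≈⟨ +-cong (*-congʳ (^-congˡ (suc q) (0≤x⇒x₊≈x (x≤y⇒0≤y-x κ≤M))))
                  (-‿cong (*-congʳ (*-congʳ (x≤0⇒x₊≈0 (gap-≤ 0≤κ (solve 1 (λ k → (con (+ 0) :- k) :+ k := con (+ 0)) refl κ)))))) ⟩
      (M - κ) ^ suc q ÷ suc q - 0# * (0# - κ) ₊ ^ q ÷ suc q
        ≈⟨ solve 3 (λ x y r → x :- (con (+ 0) :* y) :* r := x) refl _ _ _ ⟩
      (M - κ) ^ suc q ÷ suc q ∎
  integral-truncatedMoment {M} {κ} (suc k) q 0≤κ κ≤M trunc =
    integral-cong pointwise refl
      (integral-+ (integral-truncatedMoment k (suc q) 0≤κ κ≤M (inj₂ (s≤s z≤n)))
                  (integral-*ˡ κ (integral-truncatedMoment k q 0≤κ κ≤M trunc)))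
    where
    open ≈-Reasoning
    pointwise : ∀ θ → 0# ≤ θ → θ ≤ M →
      θ ^ k * (θ - κ) ₊ ^ suc q + κ * (θ ^ k * (θ - κ) ₊ ^ q) ≈ θ ^ suc k * (θ - κ) ₊ ^ q
    pointwise θ 0≤θ _ = begin
      θ ^ k * (u * u ^ q) + κ * (θ ^ k * u ^ q)
        ≈⟨ solve 4 (λ t u w k → t :* (u :* w) :+ k :* (t :* w) := t :* (w :* u) :+ k :* (t :* w)) refl (θ ^ k) u (u ^ q) κ ⟩
      θ ^ k * (u ^ q * u) + κ * (θ ^ k * u ^ q)
        ≈⟨ +-congʳ (*-congˡ (₊^-absorb q trunc 0≤θ)) ⟨
      θ ^ k * (u ^ q * (θ - κ)) + κ * (θ ^ k * u ^ q)
        ≈⟨ solve 4 (λ t x w k → t :* (w :* (x :- k)) :+ k :* (t :* w) := (x :* t) :* w) refl (θ ^ k) θ (u ^ q) κ ⟩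
      θ ^ suc k * u ^ q ∎
      where u = (θ - κ) ₊

  -- ∫₀ᴹ d(θ^(k+1) (θ - κ)^(q+1)).
  truncatedMoment-byParts : ∀ M κ k q →
    fromℕ (suc k) * truncatedMoment M κ k (suc q) + fromℕ (suc q) * truncatedMoment M κ (suc k) q ≈
    M ^ suc k * (M - κ) ^ suc q
  truncatedMoment-byParts M κ zero q = begin
    (1# + 0#) * ((M - κ) * w ÷ suc (suc q)) + n * ((M - κ) * w ÷ suc (suc q) + κ * (w ÷ suc q))
      ≈⟨ solve 6 (λ d w r s n k →
           (con (+ 1) :+ con (+ 0)) :* ((d :* w) :* r) :+ n :* ((d :* w) :* r :+ k :* (w :* s))
           := (d :* w) :* (r :* (con (+ 1) :+ n)) :+ k :* w :* (s :* n)) refl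
           (M - κ) w (recip (suc (suc q))) (recip (suc q)) n κ ⟩
    (M - κ) * w * (recip (suc (suc q)) * fromℕ (suc (suc q))) + κ * w * (recip (suc q) * n)
      ≈⟨ +-cong (*-congˡ (recip-inverse (suc (suc q)))) (*-congˡ (recip-inverse (suc q))) ⟩
    (M - κ) * w * 1# + κ * w * 1#
      ≈⟨ solve 3 (λ m k w → (m :- k) :* w :* con (+ 1) :+ k :* w :* con (+ 1) := (m :* con (+ 1)) :* w) refl M κ w ⟩
    M * 1# * w ∎
    where
    open ≈-Reasoning
    n = fromℕ (suc q)
    w = (M - κ) ^ suc q
  truncatedMoment-byParts M κ (suc k) q = begin
    (1# + x) * (J₂ + κ * J₁) + y * ((J₂ + κ * J₁) + κ * (J₁ + κ * J₀))
      ≈⟨ solve 6 (λ x y k a b c →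
           (con (+ 1) :+ x) :* (a :+ k :* b) :+ y :* ((a :+ k :* b) :+ k :* (b :+ k :* c))
           := (x :* a :+ (con (+ 1) :+ y) :* (a :+ k :* b)) :+ k :* (x :* b :+ y :* (b :+ k :* c)))
           refl x y κ J₂ J₁ J₀ ⟩
    (x * J₂ + (1# + y) * (J₂ + κ * J₁)) + κ * (x * J₁ + y * (J₁ + κ * J₀))
      ≈⟨ +-cong (truncatedMoment-byParts M κ k (suc q)) (*-congˡ (truncatedMoment-byParts M κ k q)) ⟩
    M ^ suc k * (M - κ) ^ suc (suc q) + κ * (M ^ suc k * (M - κ) ^ suc q)
      ≈⟨ solve 4 (λ m k u w → u :* ((m :- k) :* w) :+ k :* (u :* w) := (m :* u) :* w)
           refl M κ (M ^ suc k) ((M - κ) ^ suc q) ⟩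
    M ^ suc (suc k) * (M - κ) ^ suc q ∎
    where
    open ≈-Reasoning
    x = fromℕ (suc k)
    y = fromℕ (suc q)
    J₂ = truncatedMoment M κ k (suc (suc q))
    J₁ = truncatedMoment M κ k (suc q)
    J₀ = truncatedMoment M κ k q

  -- For exponent 0 the moment is the integral of θᵏ from `κ` to `M`. This ends the reduction in `q`
  -- and is where the pure power of the knot appears.
  truncatedMoment-untruncated : ∀ M κ k →
    fromℕ (suc k) * truncatedMoment M κ k 0 ≈ M ^ suc k - κ ^ suc k
  truncatedMoment-untruncated M κ zero =
    trans (solve 3 (λ m k r → (con (+ 1) :+ con (+ 0)) :* (((m :- k) :* con (+ 1)) :* r) := (m :- k) :* (r :* (con (+ 1) :+ con (+ 0))))
            refl M κ (recip 1))
    (trans (*-congˡ (recip-inverse 1))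
    (solve 2 (λ m k → (m :- k) :* con (+ 1) := m :* con (+ 1) :- k :* con (+ 1)) refl M κ))
  truncatedMoment-untruncated M κ (suc k) = begin
    (1# + x) * (J₁ + κ * J₀)
      ≈⟨ solve 4 (λ x k b c → (con (+ 1) :+ x) :* (b :+ k :* c) :=
           (x :* b :+ (con (+ 1) :+ con (+ 0)) :* (b :+ k :* c)) :+ k :* (x :* c)) refl x κ J₁ J₀ ⟩
    (x * J₁ + (1# + 0#) * (J₁ + κ * J₀)) + κ * (x * J₀)
      ≈⟨ +-cong (truncatedMoment-byParts M κ k 0) (*-congˡ (truncatedMoment-untruncated M κ k)) ⟩
    M ^ suc k * ((M - κ) * 1#) + κ * (M ^ suc k - κ ^ suc k)
      ≈⟨ solve 4 (λ m k u w → u :* ((m :- k) :* con (+ 1)) :+ k :* (u :- w) := m :* u :- k :* w)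
           refl M κ (M ^ suc k) (κ ^ suc k) ⟩
    M ^ suc (suc k) - κ ^ suc (suc k) ∎
    where
    open ≈-Reasoning
    x = fromℕ (suc k)
    J₁ = truncatedMoment M κ k 1
    J₀ = truncatedMoment M κ k 0

  -- Binomial sums and convolutions

  sum<-cong : ∀ n {f g : ℕ → ℝ} → (∀ k → k ℕ.< n → f k ≈ g k) → (∑[ k < n ] f k) ≈ (∑[ k < n ] g k)
  sum<-cong zero    f≈g = refl
  sum<-cong (suc n) f≈g = +-cong (f≈g 0 (s≤s z≤n)) (sum<-cong n (λ k k<n → f≈g (suc k) (s≤s k<n)))

  sum<-+ : ∀ n (f g : ℕ → ℝ) → (∑[ k < n ] f k + g k) ≈ (∑[ k < n ] f k) + (∑[ k < n ] g k)
  sum<-+ zero    f g = sym (+-identityˡ 0#)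
  sum<-+ (suc n) f g = trans (+-congˡ (sum<-+ n (f ∘ suc) (g ∘ suc)))
    (solve 4 (λ a b c d → (a :+ b) :+ (c :+ d) := (a :+ c) :+ (b :+ d)) refl _ _ _ _)

  sum<-*ˡ : ∀ n x (f : ℕ → ℝ) → (∑[ k < n ] x * f k) ≈ x * (∑[ k < n ] f k)
  sum<-*ˡ zero    x f = sym (zeroʳ x)
  sum<-*ˡ (suc n) x f = trans (+-congˡ (sum<-*ˡ n x (f ∘ suc))) (sym (distribˡ x _ _))

  sum<-last : ∀ n (f : ℕ → ℝ) → (∑[ k < suc n ] f k) ≈ (∑[ k < n ] f k) + f n
  sum<-last zero    f = +-comm _ _
  sum<-last (suc n) f = trans (+-congˡ (sum<-last n (f ∘ suc))) (sym (+-assoc _ _ _))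

  sum<-zero : ∀ n {f : ℕ → ℝ} → (∀ k → f k ≈ 0#) → (∑[ k < n ] f k) ≈ 0#
  sum<-zero zero    f≈0 = refl
  sum<-zero (suc n) f≈0 = trans (+-cong (f≈0 0) (sum<-zero n (f≈0 ∘ suc))) (+-identityˡ 0#)

  sum<-single : ∀ {n i} {f : ℕ → ℝ} → i ℕ.< n → (∀ k → ¬ k ≡ i → f k ≈ 0#) → (∑[ k < n ] f k) ≈ f i
  sum<-single {suc n} {zero} _ f≈0 =
    trans (+-congˡ (sum<-zero n (λ k → f≈0 (suc k) λ ()))) (+-identityʳ _)
  sum<-single {suc n} {suc i} (s≤s i<n) f≈0 =
    trans (+-cong (f≈0 0 λ ()) (sum<-single i<n (λ k k≢i → f≈0 (suc k) (k≢i ∘ ℕ.suc-injective))))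
          (+-identityˡ _)

  sumOver-cong : ∀ {b} {A : Set b} (xs : List A) {f g : A → ℝ} → (∀ x → f x ≈ g x) →
    (∑[ x ∈ xs ] f x) ≈ (∑[ x ∈ xs ] g x)
  sumOver-cong []       f≈g = refl
  sumOver-cong (x ∷ xs) f≈g = +-cong (f≈g x) (sumOver-cong xs f≈g)

  sumOver-+ : ∀ {b} {A : Set b} (xs : List A) (f g : A → ℝ) →
    (∑[ x ∈ xs ] f x + g x) ≈ (∑[ x ∈ xs ] f x) + (∑[ x ∈ xs ] g x)
  sumOver-+ []       f g = sym (+-identityˡ 0#)
  sumOver-+ (x ∷ xs) f g = trans (+-congˡ (sumOver-+ xs f g))
    (solve 4 (λ a b c d → (a :+ b) :+ (c :+ d) := (a :+ c) :+ (b :+ d)) refl _ _ _ _)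

  sumOver-*ˡ : ∀ {b} {A : Set b} (xs : List A) y (f : A → ℝ) →
    (∑[ x ∈ xs ] y * f x) ≈ y * (∑[ x ∈ xs ] f x)
  sumOver-*ˡ []       y f = sym (zeroʳ y)
  sumOver-*ˡ (x ∷ xs) y f = trans (+-congˡ (sumOver-*ˡ xs y f)) (sym (distribˡ y _ _))

  sumOver-++ : ∀ {b} {A : Set b} (xs ys : List A) (f : A → ℝ) →
    (∑[ x ∈ xs List.++ ys ] f x) ≈ (∑[ x ∈ xs ] f x) + (∑[ x ∈ ys ] f x)
  sumOver-++ []       ys f = sym (+-identityˡ _)
  sumOver-++ (x ∷ xs) ys f = trans (+-congˡ (sumOver-++ xs ys f)) (sym (+-assoc _ _ _))

  sumOver-map : ∀ {b d} {A : Set b} {B : Set d} (g : A → B) xs (f : B → ℝ) →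
    (∑[ x ∈ List.map g xs ] f x) ≈ (∑[ x ∈ xs ] f (g x))
  sumOver-map g []       f = refl
  sumOver-map g (x ∷ xs) f = +-congˡ (sumOver-map g xs f)

  sumOver-concatMap : ∀ {b d} {A : Set b} {B : Set d} (g : A → List B) xs (f : B → ℝ) →
    (∑[ y ∈ List.concatMap g xs ] f y) ≈ (∑[ x ∈ xs ] (∑[ y ∈ g x ] f y))
  sumOver-concatMap g []       f = refl
  sumOver-concatMap g (x ∷ xs) f = trans (sumOver-++ (g x) _ f) (+-congˡ (sumOver-concatMap g xs f))

  sumOver-applyUpTo : ∀ {b} {A : Set b} (g : ℕ → A) n (f : A → ℝ) →
    (∑[ x ∈ List.applyUpTo g n ] f x) ≈ (∑[ k < n ] f (g k))
  sumOver-applyUpTo g zero    f = refl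
  sumOver-applyUpTo g (suc n) f = +-congˡ (sumOver-applyUpTo (g ∘ suc) n f)

  -- Σᵢ₊ⱼ₌ₙ (n choose i) G i j, by the Leibniz rule.
  binomialSum : ℕ → (ℕ → ℕ → ℝ) → ℝ
  binomialSum zero    G = G 0 0
  binomialSum (suc n) G = binomialSum n (λ i j → G (suc i) j) + binomialSum n (λ i j → G i (suc j))

  binomialSum-cong : ∀ n {G H} → (∀ i j → G i j ≈ H i j) → binomialSum n G ≈ binomialSum n H
  binomialSum-cong zero    G≈H = G≈H 0 0
  binomialSum-cong (suc n) G≈H =
    +-cong (binomialSum-cong n (λ i j → G≈H (suc i) j)) (binomialSum-cong n (λ i j → G≈H i (suc j)))

  binomialSum-+ : ∀ n G H →
    binomialSum n (λ i j → G i j + H i j) ≈ binomialSum n G + binomialSum n H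
  binomialSum-+ zero    G H = refl
  binomialSum-+ (suc n) G H = trans (+-cong (binomialSum-+ n _ _) (binomialSum-+ n _ _))
    (solve 4 (λ a b c d → (a :+ b) :+ (c :+ d) := (a :+ c) :+ (b :+ d)) refl _ _ _ _)

  binomialSum-*ˡ : ∀ n x G → binomialSum n (λ i j → x * G i j) ≈ x * binomialSum n G
  binomialSum-*ˡ zero    x G = refl
  binomialSum-*ˡ (suc n) x G = trans (+-cong (binomialSum-*ˡ n x _) (binomialSum-*ˡ n x _)) (sym (distribˡ x _ _))

  binomialSum-zero : ∀ n {G} → (∀ i j → G i j ≈ 0#) → binomialSum n G ≈ 0#
  binomialSum-zero zero    G≈0 = G≈0 0 0
  binomialSum-zero (suc n) G≈0 = trans
    (+-cong (binomialSum-zero n (λ i j → G≈0 (suc i) j)) (binomialSum-zero n (λ i j → G≈0 i (suc j))))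
    (+-identityˡ 0#)

  -- In the Leibniz form this says that `n` derivatives followed by `m` derivatives are `m + n`
  -- derivatives. It fuses the sums over `l` and `k` into one sum of order `μ + n`.
  binomialSum-nested : ∀ m n G →
    binomialSum m (λ i j → binomialSum n (λ i′ j′ → G (i ℕ.+ i′) (j ℕ.+ j′))) ≈ binomialSum (m ℕ.+ n) G
  binomialSum-nested zero    n G = refl
  binomialSum-nested (suc m) n G =
    +-cong (binomialSum-nested m n (λ i j → G (suc i) j)) (binomialSum-nested m n (λ i j → G i (suc j)))

  binomialSum≈sum : ∀ n G → binomialSum n G ≈ (∑[ k < suc n ] fromℕ (n C k) * G k (n ∸ k))
  binomialSum≈sum zero G =
    solve 1 (λ g → g := (con (+ 1) :+ con (+ 0)) :* g :+ con (+ 0)) refl (G 0 0)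
  binomialSum≈sum (suc n) G = begin
    binomialSum n (λ i j → G (suc i) j) + binomialSum n (λ i j → G i (suc j))
      ≈⟨ +-cong (binomialSum≈sum n _) (binomialSum≈sum n _) ⟩
    A + (g₀ + (∑[ k < n ] fromℕ (n C suc k) * G (suc k) (suc (n ∸ suc k))))
      ≈⟨ +-congˡ (+-congˡ (sum<-cong n (λ k k<n → *-congˡ {fromℕ (n C suc k)} (reflexive (≡.cong (G (suc k)) (≡.sym (ℕ.+-∸-assoc 1 k<n))))))) ⟩
    A + (g₀ + (∑[ k < n ] t k))
      -- The term at `k = n` has coefficient `n C suc n`, which is 0; adding it gives both sums the
      -- same range, so that Pascal's rule applies termwise.
      ≈⟨ +-congˡ (+-congˡ (trans (sum<-last n t) (trans (+-congˡ tn≈0) (+-identityʳ _)))) ⟨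
    A + (g₀ + (∑[ k < suc n ] t k))
      ≈⟨ solve 3 (λ x y z → x :+ (y :+ z) := y :+ (x :+ z)) refl _ _ _ ⟩
    g₀ + (A + (∑[ k < suc n ] t k))
      ≈⟨ +-congˡ (sum<-+ (suc n) (λ k → fromℕ (n C k) * G (suc k) (n ∸ k)) t) ⟨
    g₀ + (∑[ k < suc n ] fromℕ (n C k) * G (suc k) (n ∸ k) + t k)
      ≈⟨ +-congˡ (sum<-cong (suc n) (λ k _ → pascal k)) ⟩
    g₀ + (∑[ k < suc n ] fromℕ (suc n C suc k) * G (suc k) (n ∸ k)) ∎
    where
    open ≈-Reasoning
    A = ∑[ k < suc n ] fromℕ (n C k) * G (suc k) (n ∸ k)
    g₀ = fromℕ (n C 0) * G 0 (suc n)
    t : ℕ → ℝ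
    t k = fromℕ (n C suc k) * G (suc k) (n ∸ k)
    tn≈0 : t n ≈ 0#
    tn≈0 = trans (*-congʳ (reflexive (≡.cong fromℕ (k>n⇒nCk≡0 (ℕ.n<1+n n))))) (zeroˡ _)
    pascal : ∀ k → fromℕ (n C k) * G (suc k) (n ∸ k) + t k ≈ fromℕ (suc n C suc k) * G (suc k) (n ∸ k)
    pascal k = trans (sym (distribʳ _ _ _)) (*-congʳ
      (trans (sym (fromℕ-+ (n C k) (n C suc k))) (reflexive (≡.cong fromℕ (nCk+nC[k+1]≡[n+1]C[k+1] n k)))))

  -- The product of exponential generating functions.
  convolution : (ℕ → ℝ) → (ℕ → ℝ) → ℕ → ℝ
  convolution f g n = binomialSum n (λ i j → f i * g j)

  convolution-cong : ∀ {f f′ g g′} → (∀ n → f n ≈ f′ n) → (∀ n → g n ≈ g′ n) →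
    ∀ n → convolution f g n ≈ convolution f′ g′ n
  convolution-cong f≈f′ g≈g′ n = binomialSum-cong n (λ i j → *-cong (f≈f′ i) (g≈g′ j))

  convolution-+ˡ : ∀ f g h n →
    convolution (λ i → f i + g i) h n ≈ convolution f h n + convolution g h n
  convolution-+ˡ f g h n = trans (binomialSum-cong n (λ i j → distribʳ _ _ _)) (binomialSum-+ n _ _)

  convolution-+ʳ : ∀ f g h n →
    convolution f (λ i → g i + h i) n ≈ convolution f g n + convolution f h n
  convolution-+ʳ f g h n = trans (binomialSum-cong n (λ i j → distribˡ _ _ _)) (binomialSum-+ n _ _)

  -- The shift of a sequence is a derivation for `convolution` by definition, so induction on `n`
  -- replaces any reindexing of double sums.
  convolution-assoc : ∀ f g h n →
    convolution (convolution f g) h n ≈ convolution f (convolution g h) n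
  convolution-assoc f g h zero    = *-assoc _ _ _
  convolution-assoc f g h (suc n) = begin
    convolution (λ i → convolution (f ∘ suc) g i + convolution f (g ∘ suc) i) h n +
      convolution (convolution f g) (h ∘ suc) n
      ≈⟨ +-congʳ (convolution-+ˡ _ _ h n) ⟩
    (convolution (convolution (f ∘ suc) g) h n + convolution (convolution f (g ∘ suc)) h n) +
      convolution (convolution f g) (h ∘ suc) n
      ≈⟨ +-cong (+-cong (convolution-assoc _ _ _ n) (convolution-assoc _ _ _ n)) (convolution-assoc _ _ _ n) ⟩
    (convolution (f ∘ suc) (convolution g h) n + convolution f (convolution (g ∘ suc) h) n) +
      convolution f (convolution g (h ∘ suc)) n
      ≈⟨ +-assoc _ _ _ ⟩
    convolution (f ∘ suc) (convolution g h) n +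
      (convolution f (convolution (g ∘ suc) h) n + convolution f (convolution g (h ∘ suc)) n)
      ≈⟨ +-congˡ (convolution-+ʳ f _ _ n) ⟨
    convolution (f ∘ suc) (convolution g h) n + convolution f (convolution g h ∘ suc) n ∎
    where open ≈-Reasoning

  convolution-comm : ∀ f g n → convolution f g n ≈ convolution g f n
  convolution-comm f g zero    = *-comm _ _
  convolution-comm f g (suc n) =
    trans (+-cong (convolution-comm _ _ n) (convolution-comm _ _ n)) (+-comm _ _)

  convolution-leftComm : ∀ f g h n →
    convolution f (convolution g h) n ≈ convolution g (convolution f h) n
  convolution-leftComm f g h n = trans (sym (convolution-assoc f g h n))
    (trans (convolution-cong (convolution-comm f g) (λ _ → refl) n) (convolution-assoc g f h n))

  convolution-identityˡ : ∀ {e} → e 0 ≈ 1# → (∀ n → e (suc n) ≈ 0#) →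
    ∀ f n → convolution e f n ≈ f n
  convolution-identityˡ e₀≈1 e₊≈0 f zero    = trans (*-congʳ e₀≈1) (*-identityˡ _)
  convolution-identityˡ e₀≈1 e₊≈0 f (suc n) = trans
    (+-cong (binomialSum-zero n (λ i j → trans (*-congʳ (e₊≈0 i)) (zeroˡ _)))
            (convolution-identityˡ e₀≈1 e₊≈0 (f ∘ suc) n))
    (+-identityˡ _)

  -- Falling factorials and Vandermonde's identity

  ↓-cong : ∀ {x y} n → x ≈ y → x ↓ n ≈ y ↓ n
  ↓-cong zero    x≈y = refl
  ↓-cong (suc n) x≈y = *-cong (↓-cong n x≈y) (+-congʳ x≈y)

  ↓-suc : ∀ x n → x ↓ suc n ≈ x * (x - 1#) ↓ n
  ↓-suc x zero    = solve 1 (λ x → con (+ 1) :* (x :- con (+ 0)) := x :* con (+ 1)) refl x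
  ↓-suc x (suc n) = trans (*-congʳ (↓-suc x n))
    (solve 3 (λ x w n → (x :* w) :* (x :- (con (+ 1) :+ n)) := x :* (w :* ((x :- con (+ 1)) :- n)))
      refl x ((x - 1#) ↓ n) (fromℕ n))

  -- Splitting off the first factor leaves `x - 1#` beside `y`, or `x` beside `y - 1#`. Both pairs
  -- have the sum `x + y - 1#`, so the two induction hypotheses carry the same falling factorial.
  vandermonde : ∀ x y n → convolution (x ↓_) (y ↓_) n ≈ (x + y) ↓ n
  vandermonde x y zero    = *-identityˡ 1#
  vandermonde x y (suc n) = begin
    convolution (λ i → x ↓ suc i) (y ↓_) n + convolution (x ↓_) (λ j → y ↓ suc j) n
      ≈⟨ +-cong
           (trans (binomialSum-cong n (λ i j → trans (*-congʳ (↓-suc x i)) (*-assoc _ _ _))) (binomialSum-*ˡ n x _))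
           (trans (binomialSum-cong n (λ i j → trans (*-congˡ (↓-suc y j))
             (solve 3 (λ u v w → u :* (v :* w) := v :* (u :* w)) refl _ _ _))) (binomialSum-*ˡ n y _)) ⟩
    x * convolution ((x - 1#) ↓_) (y ↓_) n + y * convolution (x ↓_) ((y - 1#) ↓_) n
      ≈⟨ +-cong (*-congˡ (vandermonde _ _ n)) (*-congˡ (vandermonde _ _ n)) ⟩
    x * ((x - 1#) + y) ↓ n + y * (x + (y - 1#)) ↓ n
      ≈⟨ +-cong
           (*-congˡ (↓-cong n (solve 2 (λ x y → (x :- con (+ 1)) :+ y := (x :+ y) :- con (+ 1)) refl x y)))
           (*-congˡ (↓-cong n (solve 2 (λ x y → x :+ (y :- con (+ 1)) := (x :+ y) :- con (+ 1)) refl x y))) ⟩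
    x * ((x + y) - 1#) ↓ n + y * ((x + y) - 1#) ↓ n
      ≈⟨ distribʳ _ x y ⟨
    (x + y) * ((x + y) - 1#) ↓ n
      ≈⟨ ↓-suc (x + y) n ⟨
    (x + y) ↓ suc n ∎
    where open ≈-Reasoning

  -- Multinomial sums as convolution powers

  δ₀ : ℕ → ℝ
  δ₀ zero    = 1#
  δ₀ (suc n) = 0#

  convolutionPower : (ℕ → ℝ) → ℕ → ℕ → ℝ
  convolutionPower f zero    = δ₀
  convolutionPower f (suc m) = convolution f (convolutionPower f m)

  recip-* : ∀ m n .{{_ : NonZero m}} .{{_ : NonZero n}} .{{_ : NonZero (m ℕ.* n)}} →
    recip (m ℕ.* n) ≈ recip m * recip n
  recip-* m n = begin
    recip (m ℕ.* n)
      ≈⟨ *-identityʳ _ ⟨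
    recip (m ℕ.* n) * 1#
      ≈⟨ *-congˡ (trans (*-cong (recip-inverse m) (recip-inverse n)) (*-identityˡ 1#)) ⟨
    recip (m ℕ.* n) * ((recip m * fromℕ m) * (recip n * fromℕ n))
      ≈⟨ solve 5 (λ r s m t n → r :* ((s :* m) :* (t :* n)) := (r :* (m :* n)) :* (s :* t)) refl _ _ _ _ _ ⟩
    (recip (m ℕ.* n) * (fromℕ m * fromℕ n)) * (recip m * recip n)
      ≈⟨ *-congʳ (trans (*-congˡ (sym (fromℕ-* m n))) (recip-inverse (m ℕ.* n))) ⟩
    1# * (recip m * recip n)
      ≈⟨ *-identityˡ _ ⟩
    recip m * recip n ∎
    where open ≈-Reasoning

  nCk*k![n∸k]!≡n! : ∀ {n k} → k ℕ.≤ n → (n C k) ℕ.* (k ! ℕ.* (n ∸ k) !) ≡ n !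
  nCk*k![n∸k]!≡n! {n} {k} k≤n = ≡.trans (≡.cong (ℕ._* (k ! ℕ.* (n ∸ k) !)) (nCk≡n!/k![n-k]! k≤n))
    (ℕ.m/n*n≡m {{k ℕ.!* (n ∸ k) !≢0}} (k![n∸k]!∣n! k≤n))

  multinomial-∷ : ∀ {m} n k (ks : Vector ℕ m) → k ℕ.≤ n →
    multinomial n (k Vector.∷ ks) ≈ fromℕ (n C k) * multinomial (n ∸ k) ks
  multinomial-∷ n k ks k≤n = begin
    fromℕ (n !) * recip (k ! ℕ.* ∏! ks)
      ≈⟨ *-cong (reflexive (≡.cong fromℕ (≡.sym (nCk*k![n∸k]!≡n! k≤n)))) (recip-* (k !) (∏! ks)) ⟩
    fromℕ ((n C k) ℕ.* (k ! ℕ.* (n ∸ k) !)) * (recip (k !) * recip (∏! ks))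
      ≈⟨ *-congʳ (trans (fromℕ-* (n C k) _) (*-congˡ (fromℕ-* (k !) _))) ⟩
    (fromℕ (n C k) * (fromℕ (k !) * fromℕ ((n ∸ k) !))) * (recip (k !) * recip (∏! ks))
      ≈⟨ solve 5 (λ c x y r s → (c :* (x :* y)) :* (r :* s) := (r :* x) :* (c :* (y :* s))) refl _ _ _ _ _ ⟩
    (recip (k !) * fromℕ (k !)) * (fromℕ (n C k) * (fromℕ ((n ∸ k) !) * recip (∏! ks)))
      ≈⟨ trans (*-congʳ (recip-inverse (k !))) (*-identityˡ _) ⟩
    fromℕ (n C k) * (fromℕ ((n ∸ k) !) * recip (∏! ks)) ∎
    where
    open ≈-Reasoning
    instance
      _ = ∏!≢0 ks
      _ = k ℕ.!≢0
      _ = ∏!≢0 (k Vector.∷ ks)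

  multinomialSum : (m n : ℕ) → (Vector ℕ m → ℝ) → ℝ
  multinomialSum m n g = ∑[ k ∈ tuples m n ] multinomial n k * g k

  multinomialSum-cong : ∀ m n {g h} → (∀ k → g k ≈ h k) → multinomialSum m n g ≈ multinomialSum m n h
  multinomialSum-cong m n g≈h = sumOver-cong (tuples m n) (λ k → *-congˡ (g≈h k))

  multinomialSum-+ : ∀ m n g h →
    multinomialSum m n (λ k → g k + h k) ≈ multinomialSum m n g + multinomialSum m n h
  multinomialSum-+ m n g h = trans (sumOver-cong (tuples m n) (λ k → distribˡ _ _ _)) (sumOver-+ (tuples m n) _ _)

  multinomialSum-*ˡ : ∀ m n x g → multinomialSum m n (λ k → x * g k) ≈ x * multinomialSum m n g
  multinomialSum-*ˡ m n x g = trans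
    (sumOver-cong (tuples m n) (λ k → solve 3 (λ u v w → u :* (v :* w) := v :* (u :* w)) refl (multinomial n k) x (g k)))
    (sumOver-*ˡ (tuples m n) x _)

  multinomialSum-suc : ∀ m n g →
    multinomialSum (suc m) n g ≈ binomialSum n (λ i j → multinomialSum m j (λ k → g (i Vector.∷ k)))
  multinomialSum-suc m n g = begin
    (∑[ k ∈ tuples (suc m) n ] term k)
      ≈⟨ sumOver-concatMap (λ i → List.map (i Vector.∷_) (tuples m (n ∸ i))) (List.upTo (suc n)) term ⟩
    (∑[ i ∈ List.upTo (suc n) ] (∑[ k ∈ List.map (i Vector.∷_) (tuples m (n ∸ i)) ] term k))
      ≈⟨ sumOver-applyUpTo id (suc n) _ ⟩
    (∑[ i < suc n ] (∑[ k ∈ List.map (i Vector.∷_) (tuples m (n ∸ i)) ] term k))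
      ≈⟨ sum<-cong (suc n) (λ i i<1+n → trans (sumOver-map (i Vector.∷_) (tuples m (n ∸ i)) term)
           (trans (sumOver-cong (tuples m (n ∸ i)) (λ k →
                     trans (*-congʳ (multinomial-∷ n i k (ℕ.s≤s⁻¹ i<1+n))) (*-assoc _ _ _)))
                  (sumOver-*ˡ (tuples m (n ∸ i)) _ _))) ⟩
    (∑[ i < suc n ] fromℕ (n C i) * multinomialSum m (n ∸ i) (λ k → g (i Vector.∷ k)))
      ≈⟨ binomialSum≈sum n _ ⟨
    binomialSum n (λ i j → multinomialSum m j (λ k → g (i Vector.∷ k))) ∎
    where
    open ≈-Reasoning
    term : Vector ℕ (suc m) → ℝ
    term k = multinomial n k * g k

  multinomialSum-binomialSum : ∀ m n p (G : Vector ℕ m → ℕ → ℕ → ℝ) →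
    multinomialSum m n (λ k → binomialSum p (G k)) ≈ binomialSum p (λ i j → multinomialSum m n (λ k → G k i j))
  multinomialSum-binomialSum m n zero    G = refl
  multinomialSum-binomialSum m n (suc p) G = trans (multinomialSum-+ m n _ _)
    (+-cong (multinomialSum-binomialSum m n p _) (multinomialSum-binomialSum m n p _))

  multinomialSum-0 : ∀ g → multinomialSum 0 0 g ≈ g Vector.[]
  multinomialSum-0 g = trans
    (solve 2 (λ r g → ((con (+ 1) :+ con (+ 0)) :* r) :* g :+ con (+ 0) := (r :* (con (+ 1) :+ con (+ 0))) :* g) refl (recip 1) (g Vector.[]))
    (trans (*-congʳ (recip-inverse 1)) (*-identityˡ _))

  -- Taking the first entry off both tuples leaves a summand that depends only on `i + i′` and
  -- `j + j′`, so the two binomial sums merge. For `m = 0` the empty tuple has sum 0 only, which is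
  -- why `δ₀` starts the powers.
  multinomialSum-product : ∀ (c : ℕ → ℝ) m μ n →
    multinomialSum m μ (λ l → multinomialSum m n (λ k → product (λ i → c (k i ℕ.+ l i)))) ≈
    convolutionPower c m (μ ℕ.+ n)
  multinomialSum-product c zero zero    zero    = trans
    (multinomialSum-0 (λ l → multinomialSum 0 0 (λ k → product (λ i → c (k i ℕ.+ l i)))))
    (multinomialSum-0 (λ _ → 1#))
  multinomialSum-product c zero zero    (suc n) = multinomialSum-0 (λ _ → 0#)
  multinomialSum-product c zero (suc μ) n       = refl
  multinomialSum-product c (suc m) μ n = begin
    multinomialSum (suc m) μ (λ l → multinomialSum (suc m) n (λ k → product (λ i → c (k i ℕ.+ l i))))
      ≈⟨ multinomialSum-suc m μ _ ⟩
    binomialSum μ (λ i j → multinomialSum m j (λ l → multinomialSum (suc m) n (λ k →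
      product (λ h → c (k h ℕ.+ (i Vector.∷ l) h)))))
      ≈⟨ binomialSum-cong μ (λ i j → trans
           (multinomialSum-cong m j (λ l → multinomialSum-suc m n _))
           (multinomialSum-binomialSum m j n _)) ⟩
    binomialSum μ (λ i j → binomialSum n (λ i′ j′ → multinomialSum m j (λ l → multinomialSum m j′ (λ k →
      c (i′ ℕ.+ i) * product (λ h → c (k h ℕ.+ l h))))))
      ≈⟨ binomialSum-cong μ (λ i j → binomialSum-cong n (λ i′ j′ → trans
           (multinomialSum-cong m j (λ l → multinomialSum-*ˡ m j′ _ _))
           (multinomialSum-*ˡ m j _ _))) ⟩
    binomialSum μ (λ i j → binomialSum n (λ i′ j′ →
      c (i′ ℕ.+ i) * multinomialSum m j (λ l → multinomialSum m j′ (λ k → product (λ h → c (k h ℕ.+ l h))))))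
      ≈⟨ binomialSum-cong μ (λ i j → binomialSum-cong n (λ i′ j′ →
           *-cong (reflexive (≡.cong c (ℕ.+-comm i′ i))) (multinomialSum-product c m j j′))) ⟩
    binomialSum μ (λ i j → binomialSum n (λ i′ j′ → c (i ℕ.+ i′) * convolutionPower c m (j ℕ.+ j′)))
      ≈⟨ binomialSum-nested μ n (λ i j → c i * convolutionPower c m j) ⟩
    convolution c (convolutionPower c m) (μ ℕ.+ n) ∎
    where open ≈-Reasoning

  -- Differences and moments

  -- (-1)ᵐ times the m-th forward difference of f at 0.
  alternatingSum : ℕ → (ℕ → ℝ) → ℝ
  alternatingSum zero    f = f 0
  alternatingSum (suc m) f = alternatingSum m f - alternatingSum m (f ∘ suc)

  alternatingSum-cong : ∀ m {f g} → (∀ κ → f κ ≈ g κ) → alternatingSum m f ≈ alternatingSum m g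
  alternatingSum-cong zero    f≈g = f≈g 0
  alternatingSum-cong (suc m) f≈g =
    +-cong (alternatingSum-cong m f≈g) (-‿cong (alternatingSum-cong m (f≈g ∘ suc)))

  alternatingSum-+ : ∀ m f g →
    alternatingSum m (λ κ → f κ + g κ) ≈ alternatingSum m f + alternatingSum m g
  alternatingSum-+ zero    f g = refl
  alternatingSum-+ (suc m) f g = trans
    (+-cong (alternatingSum-+ m f g) (-‿cong (alternatingSum-+ m _ _)))
    (solve 4 (λ a b c d → (a :+ b) :- (c :+ d) := (a :- c) :+ (b :- d)) refl _ _ _ _)

  alternatingSum-*ˡ : ∀ m x f → alternatingSum m (λ κ → x * f κ) ≈ x * alternatingSum m f
  alternatingSum-*ˡ zero    x f = refl
  alternatingSum-*ˡ (suc m) x f = trans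
    (+-cong (alternatingSum-*ˡ m x f) (-‿cong (alternatingSum-*ˡ m x _)))
    (solve 3 (λ x a b → x :* a :- x :* b := x :* (a :- b)) refl _ _ _)

  alternatingSum-0 : ∀ m → alternatingSum m (λ _ → 0#) ≈ 0#
  alternatingSum-0 zero    = refl
  alternatingSum-0 (suc m) = -‿inverseʳ _

  alternatingSum-sum< : ∀ m n (f : ℕ → ℕ → ℝ) →
    alternatingSum m (λ κ → ∑[ k < n ] f k κ) ≈ (∑[ k < n ] alternatingSum m (f k))
  alternatingSum-sum< m zero    f = alternatingSum-0 m
  alternatingSum-sum< m (suc n) f =
    trans (alternatingSum-+ m _ _) (+-congˡ (alternatingSum-sum< m n (f ∘ suc)))

  alternatingSum≈sum : ∀ m f →
    alternatingSum m f ≈ (∑[ κ < suc m ] fromℕ (m C κ) * ((- 1#) ^ κ * f κ))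
  alternatingSum≈sum m f = trans (viaBinomialSum m f) (binomialSum≈sum m _)
    where
    open ≈-Reasoning
    viaBinomialSum : ∀ m f → alternatingSum m f ≈ binomialSum m (λ κ _ → (- 1#) ^ κ * f κ)
    viaBinomialSum zero    f = sym (*-identityˡ _)
    viaBinomialSum (suc m) f = begin
      alternatingSum m f - alternatingSum m (f ∘ suc)
        ≈⟨ +-cong (viaBinomialSum m f) (-‿cong (viaBinomialSum m (f ∘ suc))) ⟩
      B f - B (f ∘ suc)
        ≈⟨ solve 2 (λ x y → x :- y := :- con (+ 1) :* y :+ x) refl (B f) (B (f ∘ suc)) ⟩
      - 1# * B (f ∘ suc) + B f
        ≈⟨ +-congʳ (binomialSum-*ˡ m (- 1#) _) ⟨
      binomialSum m (λ κ _ → - 1# * ((- 1#) ^ κ * f (suc κ))) + B f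
        ≈⟨ +-congʳ (binomialSum-cong m (λ κ _ → sym (*-assoc _ _ _))) ⟩
      binomialSum (suc m) (λ κ _ → (- 1#) ^ κ * f κ) ∎
      where
      B : (ℕ → ℝ) → ℝ
      B g = binomialSum m (λ κ _ → (- 1#) ^ κ * g κ)

  -- The absorption rule κ (m+1 choose κ) = (m+1) (m choose κ-1), in recursive form: a factor `κ`
  -- lowers the order of the difference by one.
  alternatingSum-κ* : ∀ m f →
    alternatingSum (suc m) (λ κ → fromℕ κ * f κ) ≈ - (fromℕ (suc m) * alternatingSum m (f ∘ suc))
  alternatingSum-κ* zero f =
    solve 2 (λ x y → con (+ 0) :* x :- (con (+ 1) :+ con (+ 0)) :* y := :- ((con (+ 1) :+ con (+ 0)) :* y))
      refl (f 0) (f 1)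
  alternatingSum-κ* (suc m) f = begin
    alternatingSum (suc m) (λ κ → fromℕ κ * f κ) - alternatingSum (suc m) (λ κ → fromℕ (suc κ) * f (suc κ))
      ≈⟨ +-cong (alternatingSum-κ* m f) (-‿cong (begin
           alternatingSum (suc m) (λ κ → fromℕ (suc κ) * f (suc κ))
             ≈⟨ alternatingSum-cong (suc m) (λ κ → solve 2 (λ n y → (con (+ 1) :+ n) :* y := y :+ n :* y) refl _ _) ⟩
           alternatingSum (suc m) (λ κ → f (suc κ) + fromℕ κ * f (suc κ))
             ≈⟨ alternatingSum-+ (suc m) (f ∘ suc) _ ⟩
           A + alternatingSum (suc m) (λ κ → fromℕ κ * f (suc κ))
             ≈⟨ +-congˡ (alternatingSum-κ* m (f ∘ suc)) ⟩
           A - n * A₂ ∎)) ⟩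
    - (n * A₁) - (A₁ - A₂ - n * A₂)
      ≈⟨ solve 3 (λ n x y → :- (n :* x) :- (x :- y :- n :* y) := :- ((con (+ 1) :+ n) :* (x :- y))) refl n A₁ A₂ ⟩
    - (fromℕ (suc (suc m)) * A) ∎
    where
    open ≈-Reasoning
    n = fromℕ (suc m)
    A = alternatingSum (suc m) (f ∘ suc)
    A₁ = alternatingSum m (f ∘ suc)
    A₂ = alternatingSum m (f ∘ suc ∘ suc)

  -- Split one factor `x - κ`. The part with `x` has smaller degree at the same order; the part with
  -- `κ` loses one in degree and one in order, with `x` shifted to `x - 1#`.
  alternatingSum-power : ∀ {m q} x → q ℕ.< m → alternatingSum m (λ κ → (x - fromℕ κ) ^ q) ≈ 0#
  alternatingSum-power {suc m} {zero}  x _ = -‿inverseʳ _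
  alternatingSum-power {suc m} {suc q} x (s≤s q<m) = begin
    alternatingSum (suc m) (λ κ → (x - fromℕ κ) * (x - fromℕ κ) ^ q)
      ≈⟨ alternatingSum-cong (suc m) (λ κ →
           solve 3 (λ x k w → (x :- k) :* w := x :* w :+ :- con (+ 1) :* (k :* w)) refl x (fromℕ κ) _) ⟩
    alternatingSum (suc m) (λ κ → x * (x - fromℕ κ) ^ q + - 1# * (fromℕ κ * (x - fromℕ κ) ^ q))
      ≈⟨ trans (alternatingSum-+ (suc m) _ _) (+-cong (alternatingSum-*ˡ (suc m) x _) (alternatingSum-*ˡ (suc m) (- 1#) _)) ⟩
    x * alternatingSum (suc m) (λ κ → (x - fromℕ κ) ^ q) +
      - 1# * alternatingSum (suc m) (λ κ → fromℕ κ * (x - fromℕ κ) ^ q)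
      ≈⟨ +-cong (*-congˡ (alternatingSum-power x (ℕ.m<n⇒m<1+n q<m))) (*-congˡ (alternatingSum-κ* m _)) ⟩
    x * 0# + - 1# * - (fromℕ (suc m) * alternatingSum m (λ κ → (x - fromℕ (suc κ)) ^ q))
      ≈⟨ +-congˡ (*-congˡ (-‿cong (*-congˡ (trans
           (alternatingSum-cong m (λ κ → ^-congˡ q
             (solve 2 (λ x k → x :- (con (+ 1) :+ k) := (x :- con (+ 1)) :- k) refl x (fromℕ κ))))
           (alternatingSum-power (x - 1#) q<m))))) ⟩
    x * 0# + - 1# * - (fromℕ (suc m) * 0#)
      ≈⟨ solve 2 (λ x n → x :* con (+ 0) :+ :- con (+ 1) :* :- (n :* con (+ 0)) := con (+ 0)) refl x _ ⟩
    0# ∎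
    where open ≈-Reasoning

  0↓suc≈0 : ∀ n → 0# ↓ suc n ≈ 0#
  0↓suc≈0 n = trans (↓-suc 0# n) (zeroˡ _)

  alternatingSum-↓-suc : ∀ m j →
    alternatingSum (suc m) (λ κ → fromℕ κ ↓ suc j) ≈ - (fromℕ (suc m) * alternatingSum m (λ κ → fromℕ κ ↓ j))
  alternatingSum-↓-suc m j = trans (alternatingSum-cong (suc m) (λ κ → ↓-suc (fromℕ κ) j))
    (trans (alternatingSum-κ* m _) (-‿cong (*-congˡ (alternatingSum-cong m (λ κ →
      ↓-cong j (solve 1 (λ k → (con (+ 1) :+ k) :- con (+ 1) := k) refl (fromℕ κ)))))))

  -- Order and degree drop together until one of them is 0: what remains is a difference of a
  -- constant, or a falling factorial of positive degree at 0.
  alternatingSum-↓-≢ : ∀ m j → ¬ j ≡ m → alternatingSum m (λ κ → fromℕ κ ↓ j) ≈ 0#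
  alternatingSum-↓-≢ zero    zero    j≢m = contradiction ≡.refl j≢m
  alternatingSum-↓-≢ zero    (suc j) j≢m = 0↓suc≈0 j
  alternatingSum-↓-≢ (suc m) zero    j≢m = -‿inverseʳ _
  alternatingSum-↓-≢ (suc m) (suc j) j≢m = trans (alternatingSum-↓-suc m j)
    (trans (-‿cong (*-congˡ (alternatingSum-↓-≢ m j (j≢m ∘ ≡.cong suc))))
           (solve 1 (λ n → :- (n :* con (+ 0)) := con (+ 0)) refl _))

  alternatingSum-↓-≡ : ∀ m → alternatingSum m (λ κ → fromℕ κ ↓ m) ≈ (- 1#) ^ m * fromℕ (m !)
  alternatingSum-↓-≡ zero    = solve 0 (con (+ 1) := con (+ 1) :* (con (+ 1) :+ con (+ 0))) refl
  alternatingSum-↓-≡ (suc m) = begin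
    alternatingSum (suc m) (λ κ → fromℕ κ ↓ suc m)
      ≈⟨ alternatingSum-↓-suc m m ⟩
    - (fromℕ (suc m) * alternatingSum m (λ κ → fromℕ κ ↓ m))
      ≈⟨ -‿cong (*-congˡ (alternatingSum-↓-≡ m)) ⟩
    - (fromℕ (suc m) * ((- 1#) ^ m * fromℕ (m !)))
      ≈⟨ solve 3 (λ n s f → :- (n :* (s :* f)) := (:- con (+ 1) :* s) :* (n :* f)) refl (fromℕ (suc m)) ((- 1#) ^ m) (fromℕ (m !)) ⟩
    (- 1# * (- 1#) ^ m) * (fromℕ (suc m) * fromℕ (m !))
      ≈⟨ *-congˡ (fromℕ-* (suc m) (m !)) ⟨
    (- 1#) ^ suc m * fromℕ (suc m !) ∎
    where open ≈-Reasoning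

  -- The explicit formula for Stirling numbers of the second kind: after expansion in falling
  -- factorials, only the term of degree `m` survives the `m`-th difference.
  alternatingSum-κ^ : ∀ {S} → IsStirlingSecond S → ∀ m k →
    alternatingSum m (λ κ → fromℕ κ ^ (m ℕ.+ k)) ≈ S (m ℕ.+ k) m * ((- 1#) ^ m * fromℕ (m !))
  alternatingSum-κ^ {S} isS m k = begin
    alternatingSum m (λ κ → fromℕ κ ^ (m ℕ.+ k))
      ≈⟨ alternatingSum-cong m (λ κ → isS (m ℕ.+ k) (fromℕ κ)) ⟩
    alternatingSum m (λ κ → ∑[ j < suc (m ℕ.+ k) ] S (m ℕ.+ k) j * fromℕ κ ↓ j)
      ≈⟨ alternatingSum-sum< m (suc (m ℕ.+ k)) (λ j κ → S (m ℕ.+ k) j * fromℕ κ ↓ j) ⟩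
    (∑[ j < suc (m ℕ.+ k) ] alternatingSum m (λ κ → S (m ℕ.+ k) j * fromℕ κ ↓ j))
      ≈⟨ sum<-cong (suc (m ℕ.+ k)) (λ j _ → alternatingSum-*ˡ m (S (m ℕ.+ k) j) (λ κ → fromℕ κ ↓ j)) ⟩
    (∑[ j < suc (m ℕ.+ k) ] S (m ℕ.+ k) j * alternatingSum m (λ κ → fromℕ κ ↓ j))
      ≈⟨ sum<-single (s≤s (ℕ.m≤m+n m k)) (λ j j≢m →
           trans (*-congˡ {S (m ℕ.+ k) j} (alternatingSum-↓-≢ m j j≢m)) (zeroʳ _)) ⟩
    S (m ℕ.+ k) m * alternatingSum m (λ κ → fromℕ κ ↓ m)
      ≈⟨ *-congˡ (alternatingSum-↓-≡ m) ⟩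
    S (m ℕ.+ k) m * ((- 1#) ^ m * fromℕ (m !)) ∎
    where open ≈-Reasoning

  -- Moments of sums of uniform variables

  integral-alternatingSum : ∀ {x y} m {f : ℕ → ℝ → ℝ} {I} → (∀ κ → IsIntegral x y (f κ) (I κ)) →
    IsIntegral x y (λ θ → alternatingSum m (λ κ → f κ θ)) (alternatingSum m I)
  integral-alternatingSum zero    ∫f = ∫f 0
  integral-alternatingSum (suc m) ∫f =
    integral-cong (λ θ _ _ → +-congˡ (-1*x≈-x _)) (+-congˡ (-1*x≈-x _))
      (integral-+ (integral-alternatingSum m ∫f) (integral-*ˡ (- 1#) (integral-alternatingSum m (∫f ∘ suc))))
    where
    -1*x≈-x : ∀ x → - 1# * x ≈ - x
    -1*x≈-x = solve 1 (λ x → :- con (+ 1) :* x := :- x) refl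

  -- k! / (m + k)!, the coefficient of the m-th primitive of x ↦ x ^ k.
  weight : ℕ → ℕ → ℝ
  weight zero    k = 1#
  weight (suc m) k = weight m k ÷ suc (m ℕ.+ k)

  weight-! : ∀ m k → weight m k * fromℕ ((m ℕ.+ k) !) ≈ fromℕ (k !)
  weight-! zero    k = *-identityˡ _
  weight-! (suc m) k = trans (*-congˡ (fromℕ-* (suc (m ℕ.+ k)) ((m ℕ.+ k) !)))
    (trans (solve 4 (λ w r n f → (w :* r) :* (n :* f) := (w :* f) :* (r :* n)) refl _ _ _ _)
    (trans (*-cong (weight-! m k) (recip-inverse (suc (m ℕ.+ k)))) (*-identityʳ _)))

  weight-suc : ∀ m k → fromℕ (suc k) * weight (suc m) k ≈ weight m (suc k)
  weight-suc zero k = trans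
    (solve 2 (λ n r → n :* (con (+ 1) :* r) := r :* n) refl (fromℕ (suc k)) (recip (suc k)))
    (recip-inverse (suc k))
  weight-suc (suc m) k rewrite ℕ.+-suc m k = trans (sym (*-assoc _ _ _)) (*-congʳ (weight-suc m k))

  weight*m!≈recip : ∀ m k → weight m k * fromℕ (m !) ≈ recip ((m ℕ.+ k) C m) {{C≢0 m k}}
  weight*m!≈recip m k = begin
    w * m!
      ≈⟨ trans (*-congʳ (recip-inverse b)) (*-identityˡ _) ⟨
    (recip b * fromℕ b) * (w * m!)
      ≈⟨ *-congˡ (trans (*-congʳ (recip-inverse (k !))) (*-identityˡ _)) ⟨
    (recip b * fromℕ b) * ((recip (k !) * k!) * (w * m!))
      ≈⟨ solve 6 (λ r c s k w m → (r :* c) :* ((s :* k) :* (w :* m)) := r :* (s :* (w :* (c :* (m :* k))))) refl _ _ _ _ _ _ ⟩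
    recip b * (recip (k !) * (w * (fromℕ b * (m! * k!))))
      ≈⟨ *-congˡ (*-congˡ (*-congˡ (trans (*-congˡ (sym (fromℕ-* (m !) (k !)))) (sym (fromℕ-* b (m ! ℕ.* k !)))))) ⟩
    recip b * (recip (k !) * (w * fromℕ (b ℕ.* (m ! ℕ.* k !))))
      ≈⟨ *-congˡ (*-congˡ (*-congˡ (reflexive (≡.cong fromℕ b*m!*k!≡[m+k]!)))) ⟩
    recip b * (recip (k !) * (w * fromℕ ((m ℕ.+ k) !)))
      ≈⟨ *-congˡ (trans (*-congˡ (weight-! m k)) (recip-inverse (k !))) ⟩
    recip b * 1#
      ≈⟨ *-identityʳ _ ⟩
    recip b ∎
    where
    open ≈-Reasoning
    instance
      _ = C≢0 m k
      _ = k ℕ.!≢0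
    b = (m ℕ.+ k) C m
    w = weight m k
    m! = fromℕ (m !)
    k! = fromℕ (k !)
    b*m!*k!≡[m+k]! : b ℕ.* (m ! ℕ.* k !) ≡ (m ℕ.+ k) !
    b*m!*k!≡[m+k]! = ≡.trans
      (≡.cong (λ j → b ℕ.* (m ! ℕ.* j !)) (≡.sym (ℕ.m+n∸m≡n m k)))
      (nCk*k![n∸k]!≡n! (ℕ.m≤m+n m k))

  -- The k-th moment of x + U₁ + ⋯ + Uₘ for independent Uᵢ uniform on [0 , 1].
  uniformMoment : ℕ → ℕ → ℝ → ℝ
  uniformMoment m k x = (weight m k * (- 1#) ^ m) * alternatingSum m (λ κ → (x + fromℕ κ) ^ (m ℕ.+ k))

  -1^m*-1^m≈1 : ∀ m → (- 1#) ^ m * (- 1#) ^ m ≈ 1#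
  -1^m*-1^m≈1 zero    = *-identityˡ 1#
  -1^m*-1^m≈1 (suc m) = trans
    (solve 1 (λ s → (:- con (+ 1) :* s) :* (:- con (+ 1) :* s) := s :* s) refl ((- 1#) ^ m)) (-1^m*-1^m≈1 m)

  -- The two signs cancel, and `weight m k * fromℕ (m !)` is the reciprocal binomial coefficient.
  -- The knots appear without `0# +` because the moments of `ρ` end in the same expression.
  uniformMoment-0 : ∀ {S} → IsStirlingSecond S → ∀ m k →
    (weight m k * (- 1#) ^ m) * alternatingSum m (λ κ → fromℕ κ ^ (m ℕ.+ k)) ≈
    (S (m ℕ.+ k) m ÷ ((m ℕ.+ k) C m)) {{C≢0 m k}}
  uniformMoment-0 {S} isS m k = begin
    (weight m k * ε) * alternatingSum m (λ κ → fromℕ κ ^ (m ℕ.+ k))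
      ≈⟨ *-congˡ (alternatingSum-κ^ {S} isS m k) ⟩
    (weight m k * ε) * (S (m ℕ.+ k) m * (ε * fromℕ (m !)))
      ≈⟨ solve 4 (λ w e s f → (w :* e) :* (s :* (e :* f)) := (e :* e) :* (s :* (w :* f))) refl _ _ _ _ ⟩
    (ε * ε) * (S (m ℕ.+ k) m * (weight m k * fromℕ (m !)))
      ≈⟨ *-cong (-1^m*-1^m≈1 m) (*-congˡ (weight*m!≈recip m k)) ⟩
    1# * (S (m ℕ.+ k) m * recip ((m ℕ.+ k) C m) {{C≢0 m k}})
      ≈⟨ *-identityˡ _ ⟩
    S (m ℕ.+ k) m * recip ((m ℕ.+ k) C m) {{C≢0 m k}} ∎
    where
    open ≈-Reasoning
    ε = (- 1#) ^ m

  -- With the knot at `- y`, not right of 0, truncation has no effect on [0 , 1]; plain powers are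
  -- thus a case of `integral-₊^`.
  integral-shiftedPower : ∀ {y} p → 0# ≤ y →
    IsIntegral 0# 1# (λ u → (y + u) ^ p) ((y + 1#) ^ suc p ÷ suc p - y ^ suc p ÷ suc p)
  integral-shiftedPower {y} p 0≤y = integral-cong
    (λ u 0≤u _ → ^-congˡ p (shifted 0≤u refl))
    (+-cong (*-congʳ (^-congˡ (suc p) (shifted (<⇒≤ 0<1) refl)))
            (-‿cong (*-congʳ (^-congˡ (suc p) (shifted ≤-refl (+-identityʳ y))))))
    (integral-₊^ {κ = - y} p (inj₁ (gap-≤ 0≤y (-‿inverseˡ y))))
    where
    shifted : ∀ {u w} → 0# ≤ u → y + u ≈ w → (u - - y) ₊ ≈ w
    shifted {u} {w} 0≤u y+u≈w = trans (0≤x⇒x₊≈x (≤-respʳ-≈ u--y≈y+u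
      (≤-respˡ-≈ (+-identityˡ 0#) (+-mono-≤ 0≤y 0≤u)))) (trans (sym u--y≈y+u) y+u≈w)
      where
      u--y≈y+u : y + u ≈ u - - y
      u--y≈y+u = solve 2 (λ y u → y :+ u := u :- :- y) refl y u

  -- The endpoint values of each integral are neighbouring values of one function of `κ`, so their
  -- difference raises the order of the alternating sum to `suc m`, while the divisor `suc p`
  -- extends the weight.
  integral-uniformMoment : ∀ m k {x} → 0# ≤ x →
    IsIntegral 0# 1# (λ u → uniformMoment m k (x + u)) (uniformMoment (suc m) k x)
  integral-uniformMoment m k {x} 0≤x = integral-cong
    (λ u _ _ → *-congˡ (alternatingSum-cong m (λ κ → ^-congˡ p
      (solve 3 (λ x u k → (x :+ k) :+ u := (x :+ u) :+ k) refl x u (fromℕ κ)))))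
    value
    (integral-*ˡ (weight m k * (- 1#) ^ m) (integral-alternatingSum m (λ κ →
      integral-shiftedPower p (≤-respˡ-≈ (+-identityˡ 0#) (+-mono-≤ 0≤x (0≤fromℕ κ))))))
    where
    open ≈-Reasoning
    p = m ℕ.+ k
    r = recip (suc p)
    G : ℕ → ℝ
    G κ = (x + fromℕ κ) ^ suc p
    value : (weight m k * (- 1#) ^ m) *
              alternatingSum m (λ κ → (x + fromℕ κ + 1#) ^ suc p ÷ suc p - G κ ÷ suc p) ≈
            uniformMoment (suc m) k x
    value = begin
      (weight m k * (- 1#) ^ m) *
        alternatingSum m (λ κ → (x + fromℕ κ + 1#) ^ suc p ÷ suc p - G κ ÷ suc p)
        ≈⟨ *-congˡ (alternatingSum-cong m (λ κ → trans
             (+-congʳ (*-congʳ (^-congˡ (suc p)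
               (solve 2 (λ x k → x :+ k :+ con (+ 1) := x :+ (con (+ 1) :+ k)) refl x (fromℕ κ)))))
             (solve 3 (λ g h r → h :* r :- g :* r := r :* h :+ :- r :* g) refl (G κ) (G (suc κ)) r))) ⟩
      (weight m k * (- 1#) ^ m) * alternatingSum m (λ κ → r * G (suc κ) + - r * G κ)
        ≈⟨ *-congˡ (trans (alternatingSum-+ m _ _) (+-cong (alternatingSum-*ˡ m r _) (alternatingSum-*ˡ m (- r) _))) ⟩
      (weight m k * (- 1#) ^ m) * (r * alternatingSum m (G ∘ suc) + - r * alternatingSum m G)
        ≈⟨ solve 5 (λ w e r h g → (w :* e) :* (r :* h :+ :- r :* g) := ((w :* r) :* (:- con (+ 1) :* e)) :* (g :- h))
             refl (weight m k) ((- 1#) ^ m) r (alternatingSum m (G ∘ suc)) (alternatingSum m G) ⟩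
      uniformMoment (suc m) k x ∎

  -- The convolution power as a Stirling sum

  integral-convolution : ∀ {x y} n {f : ℕ → ℝ → ℝ} {I : ℕ → ℝ} g → (∀ i → IsIntegral x y (f i) (I i)) →
    IsIntegral x y (λ θ → convolution (λ i → f i θ) g n) (convolution I g n)
  integral-convolution zero    g ∫f =
    integral-cong (λ θ _ _ → *-comm _ _) (*-comm _ _) (integral-*ˡ (g 0) (∫f 0))
  integral-convolution (suc n) g ∫f =
    integral-+ (integral-convolution n g (∫f ∘ suc)) (integral-convolution n (g ∘ suc) ∫f)

  -- Both sides are the expectation of (x + U₁ + ⋯ + Uₘ) ↓ N, by Vandermonde's
  -- identity and by expansion into powers; they satisfy the same integral
  -- recursion in m.
  convolutionPower-uniformMoment : ∀ {c} → IsCauchyNumbers c → ∀ {s} → IsStirlingFirst s →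
    ∀ m N x → 0# ≤ x →
    convolution (x ↓_) (convolutionPower c m) N ≈ (∑[ k < suc N ] s N k * uniformMoment m k x)
  convolutionPower-uniformMoment {c} isC {s} isS zero N x 0≤x = begin
    convolution (x ↓_) δ₀ N
      ≈⟨ convolution-comm (x ↓_) δ₀ N ⟩
    convolution δ₀ (x ↓_) N
      ≈⟨ convolution-identityˡ refl (λ _ → refl) (x ↓_) N ⟩
    x ↓ N
      ≈⟨ isS N x ⟩
    (∑[ k < suc N ] s N k * x ^ k)
      ≈⟨ sum<-cong (suc N) (λ k _ → *-congˡ {s N k} (begin
           x ^ k
             ≈⟨ ^-congˡ k (+-identityʳ x) ⟨
           (x + 0#) ^ k
             ≈⟨ solve 1 (λ y → y := (con (+ 1) :* con (+ 1)) :* y) refl _ ⟩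
           uniformMoment 0 k x ∎)) ⟩
    (∑[ k < suc N ] s N k * uniformMoment 0 k x) ∎
    where open ≈-Reasoning
  -- Both sides integrate the same function of `u`. In its convolution form each `u ↓ i` integrates
  -- to `c i`, supplying the new factor; the induction hypothesis at `x + u` gives its moment form.
  convolutionPower-uniformMoment {c} isC {s} isS (suc m) N x 0≤x = integral-unique
    (integral-cong pointwise
      (convolution-leftComm c (x ↓_) (convolutionPower c m) N)
      (integral-convolution N (convolution (x ↓_) (convolutionPower c m)) isC))
    (integral-sum (suc N) (λ k _ → integral-*ˡ (s N k) (integral-uniformMoment m k 0≤x)))
    where
    open ≈-Reasoning
    pointwise : ∀ u → 0# ≤ u → u ≤ 1# →
      convolution (u ↓_) (convolution (x ↓_) (convolutionPower c m)) N ≈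
      (∑[ k < suc N ] s N k * uniformMoment m k (x + u))
    pointwise u 0≤u _ = begin
      convolution (u ↓_) (convolution (x ↓_) (convolutionPower c m)) N
        ≈⟨ convolution-leftComm (u ↓_) (x ↓_) _ N ⟩
      convolution (x ↓_) (convolution (u ↓_) (convolutionPower c m)) N
        ≈⟨ convolution-assoc (x ↓_) (u ↓_) _ N ⟨
      convolution (convolution (x ↓_) (u ↓_)) (convolutionPower c m) N
        ≈⟨ convolution-cong (vandermonde x u) (λ _ → refl) N ⟩
      convolution ((x + u) ↓_) (convolutionPower c m) N
        ≈⟨ convolutionPower-uniformMoment isC {s} isS m N (x + u)
             (≤-respˡ-≈ (+-identityˡ 0#) (+-mono-≤ 0≤x 0≤u)) ⟩
      (∑[ k < suc N ] s N k * uniformMoment m k (x + u)) ∎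

  convolutionPower-Stirling : ∀ {c} → IsCauchyNumbers c → ∀ {s} → IsStirlingFirst s →
    ∀ {S} → IsStirlingSecond S → ∀ m N →
    convolutionPower c m N ≈ (∑[ k < suc N ] (s N k * S (m ℕ.+ k) m ÷ ((m ℕ.+ k) C m)) {{C≢0 m k}})
  convolutionPower-Stirling {c} isC {s} isS₁ {S} isS₂ m N = begin
    convolutionPower c m N
      -- At `x = 0` the falling factorials are the unit of `convolution`.
      ≈⟨ convolution-identityˡ refl 0↓suc≈0 (convolutionPower c m) N ⟨
    convolution (0# ↓_) (convolutionPower c m) N
      ≈⟨ convolutionPower-uniformMoment isC {s} isS₁ m N 0# ≤-refl ⟩
    (∑[ k < suc N ] s N k * uniformMoment m k 0#)
      ≈⟨ sum<-cong (suc N) (λ k _ → trans (*-congˡ {s N k} (trans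
           (*-congˡ (alternatingSum-cong m (λ κ → ^-congˡ (m ℕ.+ k) (+-identityˡ _))))
           (uniformMoment-0 {S} isS₂ m k))) (sym (*-assoc (s N k) (S (m ℕ.+ k) m) _))) ⟩
    (∑[ k < suc N ] (s N k * S (m ℕ.+ k) m ÷ ((m ℕ.+ k) C m)) {{C≢0 m k}}) ∎
    where open ≈-Reasoning

  -- Moments of the spline `ρ`

  truncatedMoment-degenerate : ∀ {M κ} k q → M - κ ≈ 0# → truncatedMoment M κ k q ≈ 0#
  truncatedMoment-degenerate zero    q M-κ≈0 =
    trans (*-congʳ (trans (*-congʳ M-κ≈0) (zeroˡ _))) (zeroˡ _)
  truncatedMoment-degenerate (suc k) q M-κ≈0 = trans
    (+-cong (truncatedMoment-degenerate k (suc q) M-κ≈0) (*-congˡ (truncatedMoment-degenerate k q M-κ≈0)))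
    (trans (+-identityˡ _) (zeroʳ _))

  fromℕ-suc-cancelˡ : ∀ n {x y} → fromℕ (suc n) * x ≈ fromℕ (suc n) * y → x ≈ y
  fromℕ-suc-cancelˡ n nx≈ny =
    trans (sym ([n*x]÷n≈x (suc n) _)) (trans (*-congʳ nx≈ny) ([n*x]÷n≈x (suc n) _))

  -- Partial integration moves all powers of θ - κ to θ, as the boundary terms
  -- are polynomials in κ of degree less than m.
  alternatingSum-truncatedMoment : ∀ {m} M k q → q ℕ.< m →
    alternatingSum m (λ κ → truncatedMoment M (fromℕ κ) k q) ≈
    fromℕ (q !) * ((weight (suc q) k * (- 1#) ^ suc q) * alternatingSum m (λ κ → fromℕ κ ^ (suc q ℕ.+ k)))
  alternatingSum-truncatedMoment {suc m} M k zero _ = fromℕ-suc-cancelˡ k (begin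
    fromℕ (suc k) * A (λ κ → truncatedMoment M (fromℕ κ) k 0)
      ≈⟨ alternatingSum-*ˡ (suc m) _ _ ⟨
    A (λ κ → fromℕ (suc k) * truncatedMoment M (fromℕ κ) k 0)
      ≈⟨ alternatingSum-cong (suc m) (λ κ → trans (truncatedMoment-untruncated M (fromℕ κ) k)
           (solve 2 (λ x y → x :- y := x :* con (+ 1) :+ :- con (+ 1) :* y) refl _ _)) ⟩
    A (λ κ → M ^ suc k * 1# + - 1# * fromℕ κ ^ suc k)
      ≈⟨ trans (alternatingSum-+ (suc m) _ _) (+-cong (alternatingSum-*ˡ (suc m) _ _) (alternatingSum-*ˡ (suc m) _ _)) ⟩
    M ^ suc k * A (λ _ → 1#) + - 1# * P
      ≈⟨ +-congʳ (*-congˡ (-‿inverseʳ _)) ⟩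
    M ^ suc k * 0# + - 1# * P
      ≈⟨ solve 2 (λ u y → u :* con (+ 0) :+ :- con (+ 1) :* y := con (+ 1) :* (:- con (+ 1) :* y)) refl (M ^ suc k) P ⟩
    1# * (- 1# * P)
      ≈⟨ *-congʳ (recip-inverse (suc k)) ⟨
    (recip (suc k) * fromℕ (suc k)) * (- 1# * P)
      ≈⟨ solve 3 (λ r n y → (r :* n) :* (:- con (+ 1) :* y) :=
           n :* ((con (+ 1) :+ con (+ 0)) :* (((con (+ 1) :* r) :* (:- con (+ 1) :* con (+ 1))) :* y)))
           refl (recip (suc k)) (fromℕ (suc k)) P ⟩
    fromℕ (suc k) * (fromℕ 1 * ((weight 1 k * (- 1#) ^ 1) * P)) ∎)
    where
    open ≈-Reasoning
    A = alternatingSum (suc m)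
    P = A (λ κ → fromℕ κ ^ suc k)
  alternatingSum-truncatedMoment {m} M k (suc q) 1+q<m = fromℕ-suc-cancelˡ k (begin
    n * A (λ κ → truncatedMoment M (fromℕ κ) k (suc q))
      ≈⟨ alternatingSum-*ˡ m _ _ ⟨
    A (λ κ → n * truncatedMoment M (fromℕ κ) k (suc q))
      ≈⟨ alternatingSum-cong m (λ κ → trans
           (solve 3 (λ x y j → x := (x :+ y :* j) :+ :- y :* j) refl _ _ _)
           (+-congʳ (truncatedMoment-byParts M (fromℕ κ) k q))) ⟩
    A (λ κ → M ^ suc k * (M - fromℕ κ) ^ suc q + - fromℕ (suc q) * truncatedMoment M (fromℕ κ) (suc k) q)
      ≈⟨ trans (alternatingSum-+ m _ _) (+-cong (alternatingSum-*ˡ m _ _) (alternatingSum-*ˡ m _ _)) ⟩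
    M ^ suc k * A (λ κ → (M - fromℕ κ) ^ suc q) + - fromℕ (suc q) * A (λ κ → truncatedMoment M (fromℕ κ) (suc k) q)
      ≈⟨ +-cong (*-congˡ (alternatingSum-power M 1+q<m))
                (*-congˡ (alternatingSum-truncatedMoment M (suc k) q (ℕ.<⇒≤ 1+q<m))) ⟩
    M ^ suc k * 0# + - fromℕ (suc q) * (fromℕ (q !) * ((weight (suc q) (suc k) * ε) * A (λ κ → fromℕ κ ^ (suc q ℕ.+ suc k))))
      -- `weight-suc` exposes the factor `n` that is to be cancelled. The exponents agree since
      -- trading a power of `θ - κ` for one of `θ` keeps the total degree.
      ≈⟨ +-congˡ (*-congˡ (*-congˡ (*-cong (*-congʳ (sym (weight-suc (suc q) k)))
           (reflexive (≡.cong (λ e → A (λ κ → fromℕ κ ^ e)) (≡.cong suc (ℕ.+-suc q k))))))) ⟩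
    M ^ suc k * 0# + - fromℕ (suc q) * (fromℕ (q !) * (((n * w) * ε) * P))
      ≈⟨ solve 7 (λ u x f n w e y →
           u :* con (+ 0) :+ :- x :* (f :* (((n :* w) :* e) :* y)) :=
           n :* ((x :* f) :* ((w :* (:- con (+ 1) :* e)) :* y)))
           refl (M ^ suc k) (fromℕ (suc q)) (fromℕ (q !)) n w ε P ⟩
    n * ((fromℕ (suc q) * fromℕ (q !)) * ((w * (- 1#) ^ suc (suc q)) * P))
      ≈⟨ *-congˡ (*-congʳ (fromℕ-* (suc q) (q !))) ⟨
    n * (fromℕ (suc q !) * ((w * (- 1#) ^ suc (suc q)) * P)) ∎)
    where
    open ≈-Reasoning
    A = alternatingSum m
    n = fromℕ (suc k)
    w = weight (suc (suc q)) k
    ε = (- 1#) ^ suc q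
    P = A (λ κ → fromℕ κ ^ (suc (suc q) ℕ.+ k))

  fromℕ-mono-≤ : ∀ {m n} → m ℕ.≤ n → fromℕ m ≤ fromℕ n
  fromℕ-mono-≤ {n = n} z≤n = 0≤fromℕ n
  fromℕ-mono-≤ (s≤s m≤n)   = +-mono-≤ ≤-refl (fromℕ-mono-≤ m≤n)

  -- Here `m` is the exponent of the spline. When it is 0 the only knot is 0, the left endpoint, so
  -- the convention for `0 ^ 0` does no harm.
  splineTruncates : ∀ {κ m} → κ ℕ.< suc m → Truncates (fromℕ κ) 0# m
  splineTruncates {κ} {zero}  κ<1 = inj₁ (fromℕ-mono-≤ (ℕ.s≤s⁻¹ κ<1))
  splineTruncates {κ} {suc m} _   = inj₂ (s≤s z≤n)

  integral-power*ρ : ∀ {S} → IsStirlingSecond S → ∀ m′ k → let m = suc m′ in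
    IsIntegral 0# (fromℕ m) (λ θ → θ ^ k * ρ m θ) ((S (m ℕ.+ k) m ÷ ((m ℕ.+ k) C m)) {{C≢0 m k}})
  integral-power*ρ {S} isS m′ k = integral-cong pointwise value
    (integral-*ˡ r (integral-sum m (λ κ κ<m → integral-*ˡ (C± κ)
      (integral-truncatedMoment k m′ (0≤fromℕ κ) (fromℕ-mono-≤ (ℕ.<⇒≤ κ<m)) (splineTruncates κ<m)))))
    where
    open ≈-Reasoning
    instance _ = m′ ℕ.!≢0
    m = suc m′
    r = recip (m′ !)
    C± : ℕ → ℝ
    C± κ = fromℕ (m C κ) * (- 1#) ^ κ
    J : ℕ → ℝ
    J κ = truncatedMoment (fromℕ m) (fromℕ κ) k m′
    pointwise : ∀ θ → 0# ≤ θ → θ ≤ fromℕ m →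
      r * (∑[ κ < m ] C± κ * (θ ^ k * (θ - fromℕ κ) ₊ ^ m′)) ≈ θ ^ k * ρ m θ
    pointwise θ _ _ = begin
      r * (∑[ κ < m ] C± κ * (θ ^ k * (θ - fromℕ κ) ₊ ^ m′))
        ≈⟨ *-congˡ (trans
             (sum<-cong m (λ κ _ → solve 3 (λ x y z → x :* (y :* z) := y :* (x :* z)) refl (C± κ) (θ ^ k) ((θ - fromℕ κ) ₊ ^ m′)))
             (sum<-*ˡ m (θ ^ k) (λ κ → C± κ * (θ - fromℕ κ) ₊ ^ m′))) ⟩
      r * (θ ^ k * (∑[ κ < m ] C± κ * (θ - fromℕ κ) ₊ ^ m′))
        ≈⟨ solve 3 (λ r t u → r :* (t :* u) := t :* (u :* r)) refl r (θ ^ k) _ ⟩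
      θ ^ k * ρ m θ ∎
    P = alternatingSum m (λ κ → fromℕ κ ^ (m ℕ.+ k))
    value : r * (∑[ κ < m ] C± κ * J κ) ≈ (S (m ℕ.+ k) m ÷ ((m ℕ.+ k) C m)) {{C≢0 m k}}
    value = begin
      r * (∑[ κ < m ] C± κ * J κ)
        -- `ρ` stops at the knot `m - 1`, whereas an `m`-th difference also involves `m`. That knot
        -- is the right endpoint, where the moment is 0, so the term can be added.
        ≈⟨ *-congˡ (trans (sum<-last m (λ κ → C± κ * J κ)) (trans
             (+-congˡ (trans (*-congˡ (truncatedMoment-degenerate k m′ (-‿inverseʳ _))) (zeroʳ _)))
             (+-identityʳ _))) ⟨
      r * (∑[ κ < suc m ] C± κ * J κ)
        ≈⟨ *-congˡ (trans (alternatingSum≈sum m J) (sum<-cong (suc m) (λ κ _ → sym (*-assoc (fromℕ (m C κ)) ((- 1#) ^ κ) (J κ))))) ⟨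
      r * alternatingSum m J
        -- `m′` is the largest exponent whose boundary terms an `m`-th difference still annihilates;
        -- the factorial it produces cancels the normalisation of `ρ`.
        ≈⟨ *-congˡ (alternatingSum-truncatedMoment (fromℕ m) k m′ (ℕ.n<1+n m′)) ⟩
      r * (fromℕ (m′ !) * ((weight m k * (- 1#) ^ m) * P))
        ≈⟨ trans (sym (*-assoc _ _ _)) (trans (*-congʳ (recip-inverse (m′ !))) (*-identityˡ _)) ⟩
      (weight m k * (- 1#) ^ m) * P
        ≈⟨ uniformMoment-0 {S} isS m k ⟩
      (S (m ℕ.+ k) m ÷ ((m ℕ.+ k) C m)) {{C≢0 m k}} ∎

  integral-falling*ρ : ∀ {s} → IsStirlingFirst s → ∀ {S} → IsStirlingSecond S → ∀ N m .{{_ : NonZero m}} →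
    IsIntegral 0# (fromℕ m) (λ θ → θ ↓ N * ρ m θ)
      (∑[ k < suc N ] (s N k * S (m ℕ.+ k) m ÷ ((m ℕ.+ k) C m)) {{C≢0 m k}})
  integral-falling*ρ {s} isS₁ {S} isS₂ N m@(suc m′) = integral-cong pointwise
    (sum<-cong (suc N) (λ k _ → sym (*-assoc (s N k) (S (m ℕ.+ k) m) (recip ((m ℕ.+ k) C m) {{C≢0 m k}}))))
    (integral-sum (suc N) {I = λ k → s N k * (S (m ℕ.+ k) m ÷ ((m ℕ.+ k) C m)) {{C≢0 m k}}}
      (λ k _ → integral-*ˡ (s N k) (integral-power*ρ {S} isS₂ m′ k)))
    where
    open ≈-Reasoning
    pointwise : ∀ θ → 0# ≤ θ → θ ≤ fromℕ m →
      (∑[ k < suc N ] s N k * (θ ^ k * ρ m θ)) ≈ θ ↓ N * ρ m θ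
    pointwise θ _ _ = begin
      (∑[ k < suc N ] s N k * (θ ^ k * ρ m θ))
        ≈⟨ sum<-cong (suc N) (λ k _ → solve 3 (λ x y z → x :* (y :* z) := z :* (x :* y)) refl (s N k) (θ ^ k) (ρ m θ)) ⟩
      (∑[ k < suc N ] ρ m θ * (s N k * θ ^ k))
        ≈⟨ sum<-*ˡ (suc N) (ρ m θ) (λ k → s N k * θ ^ k) ⟩
      ρ m θ * (∑[ k < suc N ] s N k * θ ^ k)
        ≈⟨ *-comm _ _ ⟩
      (∑[ k < suc N ] s N k * θ ^ k) * ρ m θ
        ≈⟨ *-congʳ (isS₁ N θ) ⟨
      θ ↓ N * ρ m θ ∎

theorem1 : ∀ {a ℓ₁ ℓ₂} (R : RealNumbers a ℓ₁ ℓ₂) →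
  let open RealNumbers R renaming (Carrier to ℝ)
      open RealAnalysis R
  in
  (c : ℕ → ℝ) → IsCauchyNumbers c →
  (s S : ℕ → ℕ → ℝ) → IsStirlingFirst s → IsStirlingSecond S →
  (n μ m : ℕ) .{{_ : NonZero m}} →
  ∃[ I ]
    IsIntegral 0# (fromℕ m) (λ θ → θ ↓ (μ ℕ.+ n) * ρ m θ) I
    ∧ (∑[ l ∈ tuples m μ ] multinomial μ l *
        (∑[ k ∈ tuples m n ] multinomial n k *
          product (λ i → c (k i ℕ.+ l i)))) ≈ I
    ∧ I ≈ (∑[ k < ℕ.suc (μ ℕ.+ n) ]
        (s (μ ℕ.+ n) k * S (m ℕ.+ k) m ÷ ((m ℕ.+ k) C m)) {{C≢0 m k}})
theorem1 R c isC s S isS₁ isS₂ n μ m =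
  -- The witness `I` is the Stirling sum itself, so the last equation is reflexivity.
  _ , integral-falling*ρ R {s} isS₁ {S} isS₂ (μ ℕ.+ n) m
    , CommutativeRing.trans commutativeRing (multinomialSum-product R c m μ n)
        (convolutionPower-Stirling R isC {s} isS₁ {S} isS₂ m (μ ℕ.+ n))
    , CommutativeRing.refl commutativeRing
  where open RealNumbers R using (commutativeRing)
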